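{- Let $d$ be a positive integer. The complete theory of the structure $(\mathbb{Z},+,d^{\mathbb{N}},\times\restriction_{d^{\mathbb{N}}})$ is NIP, where $d^{\mathbb{N}}=\{d^k:k\in\mathbb{N}\}$ is a unary predicate and $\times\restriction_{d^{\mathbb{N}}}=\{(a,b,c)\in(d^{\mathbb{N}})^3: ab=c\}$ is a ternary predicate.
   Context: $\mathbb{N}=\{0,1,2,\ldots\}$. -}

module Defs where

open import Data.Nat using (ℕ; _^_; _≤_)
open import Data.Integer using (ℤ; +_; _+_; _*_)
open import Data.Fin using (Fin; zero; suc)
open import Data.Bool using (Bool; T)
open import Data.Product using (Σ; _×_; ∃)
open import Data.Empty using (⊥)
open import Data.Vec.Functional using (Vector; _++_; _∷_)
open import Relation.Binary.PropositionalEquality using (_≡_)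
open import Relation.Nullary using (¬_)

data Term (n : ℕ) : Set where
  var  : Fin n → Term n
  plus : Term n → Term n → Term n

data Formula : ℕ → Set where
  falsum : ∀ {n} → Formula n
  equal  : ∀ {n} → Term n → Term n → Formula n
  pow    : ∀ {n} → Term n → Formula n
  mul    : ∀ {n} → Term n → Term n → Term n → Formula n
  neg    : ∀ {n} → Formula n → Formula n
  conj   : ∀ {n} → Formula n → Formula n → Formula n
  disj   : ∀ {n} → Formula n → Formula n → Formula n
  impl   : ∀ {n} → Formula n → Formula n → Formula n
  all    : ∀ {n} → Formula (ℕ.suc n) → Formula n
  ex     : ∀ {n} → Formula (ℕ.suc n) → Formula n

InPow : ℕ → ℤ → Set
InPow d x = ∃ λ (k : ℕ) → x ≡ + (d ^ k)

MulPow : ℕ → ℤ → ℤ → ℤ → Set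
MulPow d a b c = InPow d a × InPow d b × InPow d c × (a * b ≡ c)

evalT : ∀ {n} → Vector ℤ n → Term n → ℤ
evalT ρ (var i)    = ρ i
evalT ρ (plus s t) = evalT ρ s + evalT ρ t

-- Classical (Tarskian) satisfaction via the negative translation:
-- atoms, ∨ and ∃ are double-negated so that the truth value agrees
-- with the classical one.
Sat : ℕ → ∀ {n} → Vector ℤ n → Formula n → Set
Sat d ρ falsum      = ⊥
Sat d ρ (equal s t) = ¬ ¬ (evalT ρ s ≡ evalT ρ t)
Sat d ρ (pow t)     = ¬ ¬ InPow d (evalT ρ t)
Sat d ρ (mul s t u) = ¬ ¬ MulPow d (evalT ρ s) (evalT ρ t) (evalT ρ u)
Sat d ρ (neg φ)     = ¬ Sat d ρ φ
Sat d ρ (conj φ ψ)  = Sat d ρ φ × Sat d ρ ψ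
Sat d ρ (disj φ ψ)  = ¬ (¬ Sat d ρ φ × ¬ Sat d ρ ψ)
Sat d ρ (impl φ ψ)  = Sat d ρ φ → Sat d ρ ψ
Sat d ρ (all φ)     = (x : ℤ) → Sat d (x ∷ ρ) φ
Sat d ρ (ex φ)      = ¬ ((x : ℤ) → ¬ Sat d (x ∷ ρ) φ)

Shatters : (d k m : ℕ) → Formula (k Data.Nat.+ m) → ℕ → Set
Shatters d k m φ N =
  Σ (Fin N → Vector ℤ k) λ a →
    (J : Fin N → Bool) →
      ¬ ¬ Σ (Vector ℤ m) λ b →
        (i : Fin N) → (Sat d (a i ++ b) φ → T (J i)) × (T (J i) → Sat d (a i ++ b) φ)

-- φ(x̄;ȳ) is NIP in Th(M): it does not shatter arbitrarily large finite sets
-- in M (equivalent, for the complete theory of M, to the usual definition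
-- by compactness).
NIPFormula : (d k m : ℕ) → Formula (k Data.Nat.+ m) → Set
NIPFormula d k m φ = ¬ ((N : ℕ) → Shatters d k m φ N)

NIPTheory : ℕ → Set
NIPTheory d = (k m : ℕ) (φ : Formula (k Data.Nat.+ m)) → NIPFormula d k m φ

{-# OPTIONS --safe #-}
module Submission where

-- An integer y can be replaced by a rational combination of finitely many parameters and powers of D, of
-- complexity depending only on the formula, without changing the signs and small residues of short
-- linear forms in y, the parameters and all powers of D.  Exponents can likewise be replaced by rational
-- combinations of thresholds: for fixed v, the sign of v + Σ fᵢ D^eᵢ is a Presburger condition on the eᵢ
-- and on finitely many iterated logarithms of v.  A back-and-forth argument shows that both
-- replacements preserve the truth of formulas, so every trace on a₁, …, a_N is that of a tuple determined
-- by a code over a₁, …, a_N.  The number of codes is polynomial in N, hence below 2^N for some N.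

open import Defs
open import Data.Bool using (Bool; true; false; T)
open import Data.Empty using (⊥; ⊥-elim)
open import Data.Fin using (Fin; zero; suc; toℕ; fromℕ<; _↑ˡ_; _↑ʳ_; splitAt; join; combine; inject≤; finToFun; funToFin)
import Data.Fin.Properties as Finₚ
open import Data.Integer as ℤ using (ℤ; +_; -[1+_]; 0ℤ; 1ℤ; _+_; _*_; -_; _-_; _<_; ∣_∣; +≤+) renaming (_≤_ to _≤ᶻ_)
open import Data.Integer.Divisibility.Signed using (_∣_; divides; ∣ᵤ⇒∣; ∣m∣n⇒∣m+n; ∣m⇒∣-m; ∣m⇒∣m*n; *-cancelˡ-∣)
import Data.Integer.Properties as ℤₚ
open import Data.Integer.Tactic.RingSolver using (solve-∀)
open import Data.Maybe as Maybe using (Maybe; just; nothing; maybe′)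
open import Data.Nat as ℕ using (ℕ; zero; suc; _≤_; z≤n; s≤s; _^_; _!)
import Data.Nat.Divisibility as ℕ∣
open import Data.Nat.DivMod using (_%_; _/_; m%n<n; m≡m%n+[m/n]*n)
import Data.Nat.Properties as ℕₚ
open import Data.Product using (Σ; _×_; _,_; proj₁; proj₂)
open import Data.Sum as Sum using (_⊎_; inj₁; inj₂) renaming ([_,_]′ to [_,_])
open import Data.Sum.Properties using (inj₁-injective; inj₂-injective)
open import Data.Unit using (⊤; tt)
open import Data.Vec using (Vec; []; _∷_)
open import Data.Vec.Functional using (Vector; _++_; tail) renaming ([] to []ᶠ; _∷_ to _∷ᶠ_)
import Data.Vec.Functional.Properties as Vecₚ
open import Data.Vec.Relation.Unary.All as All using (All; []; _∷_)
open import Function using (_∘_; id)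
open import Relation.Binary using (tri<; tri≈; tri>)
open import Relation.Binary.PropositionalEquality hiding ([_])
open import Relation.Nullary using (¬_; yes; no)

-- The obstacle is that moving an integer also moves the powers of D in its description. A
-- replacement of y is a combination of parameters and powers of D; in the other tuple these powers
-- have other exponents, and later moves add further ones. `Coupled` therefore relates u and u'
-- under every pair of exponent tuples that are similar over e and e', not under one fixed matching
-- of powers. For this to survive a move, y is compared with its replacement over all powers of D at
-- once, an infinite alphabet; only afterwards are the finitely many exponents that its code
-- mentions extracted. Multiplication is then linear: on powers of D it is addition of exponents.
-- All levels of similarity are computed from the formula. Choices are made only under double
-- negation, which is harmless because satisfaction is stable.

-- Words and similarity

-- A signed sum of at most k letters: integer coefficients are written by repeating letters.
data Word (I : Set) : ℕ → Set where
  nil : ∀ {k} → Word I k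
  add : ∀ {k} → I → Word I k → Word I (suc k)
  sub : ∀ {k} → I → Word I k → Word I (suc k)

⟦_⟧ : ∀ {I k} → Word I k → (I → ℤ) → ℤ
⟦ nil ⟧     x = 0ℤ
⟦ add i w ⟧ x = x i + ⟦ w ⟧ x
⟦ sub i w ⟧ x = - x i + ⟦ w ⟧ x

mapʷ : ∀ {I J k} → (I → J) → Word I k → Word J k
mapʷ f nil       = nil
mapʷ f (add i w) = add (f i) (mapʷ f w)
mapʷ f (sub i w) = sub (f i) (mapʷ f w)

⟦⟧-map : ∀ {I J k} (f : I → J) (w : Word I k) {x : I → ℤ} {y : J → ℤ} →
         (∀ i → x i ≡ y (f i)) → ⟦ w ⟧ x ≡ ⟦ mapʷ f w ⟧ y
⟦⟧-map f nil       eq = refl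
⟦⟧-map f (add i w) eq = cong₂ _+_ (eq i) (⟦⟧-map f w eq)
⟦⟧-map f (sub i w) eq = cong₂ (λ a b → - a + b) (eq i) (⟦⟧-map f w eq)

⟦⟧-cong : ∀ {I k} (w : Word I k) {x y : I → ℤ} → (∀ i → x i ≡ y i) → ⟦ w ⟧ x ≡ ⟦ w ⟧ y
⟦⟧-cong nil       eq = refl
⟦⟧-cong (add i w) eq = cong₂ _+_ (eq i) (⟦⟧-cong w eq)
⟦⟧-cong (sub i w) eq = cong₂ (λ a b → - a + b) (eq i) (⟦⟧-cong w eq)

weaken : ∀ {I k l} → k ℕ.≤ l → Word I k → Word I l
weaken _       nil       = nil
weaken (s≤s p) (add i w) = add i (weaken p w)
weaken (s≤s p) (sub i w) = sub i (weaken p w)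

⟦⟧-weaken : ∀ {I k l} (p : k ℕ.≤ l) (w : Word I k) (x : I → ℤ) → ⟦ weaken p w ⟧ x ≡ ⟦ w ⟧ x
⟦⟧-weaken _       nil       x = refl
⟦⟧-weaken (s≤s p) (add i w) x = cong (λ v → x i + v) (⟦⟧-weaken p w x)
⟦⟧-weaken (s≤s p) (sub i w) x = cong (λ v → - x i + v) (⟦⟧-weaken p w x)

infixr 5 _⧺_

_⧺_ : ∀ {I k l} → Word I k → Word I l → Word I (k ℕ.+ l)
_⧺_ {k = k} {l} nil v = weaken (ℕₚ.m≤n+m l k) v
add i w ⧺ v = add i (w ⧺ v)
sub i w ⧺ v = sub i (w ⧺ v)

⟦⟧-⧺ : ∀ {I k l} (w : Word I k) (v : Word I l) (x : I → ℤ) → ⟦ w ⧺ v ⟧ x ≡ ⟦ w ⟧ x + ⟦ v ⟧ x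
⟦⟧-⧺ {k = k} {l} nil v x = trans (⟦⟧-weaken (ℕₚ.m≤n+m l k) v x) (sym (ℤₚ.+-identityˡ _))
⟦⟧-⧺ (add i w) v x = trans (cong (λ v → x i + v) (⟦⟧-⧺ w v x)) (sym (ℤₚ.+-assoc (x i) _ _))
⟦⟧-⧺ (sub i w) v x = trans (cong (λ v → - x i + v) (⟦⟧-⧺ w v x)) (sym (ℤₚ.+-assoc (- x i) _ _))

negateʷ : ∀ {I k} → Word I k → Word I k
negateʷ nil       = nil
negateʷ (add i w) = sub i (negateʷ w)
negateʷ (sub i w) = add i (negateʷ w)

⟦⟧-negate : ∀ {I k} (w : Word I k) (x : I → ℤ) → ⟦ negateʷ w ⟧ x ≡ - ⟦ w ⟧ x
⟦⟧-negate nil       x = refl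
⟦⟧-negate (add i w) x = trans (cong (λ v → - x i + v) (⟦⟧-negate w x)) (sym (ℤₚ.neg-distrib-+ (x i) _))
⟦⟧-negate (sub i w) x = trans (cong₂ _+_ (sym (ℤₚ.neg-involutive (x i))) (⟦⟧-negate w x))
                           (sym (ℤₚ.neg-distrib-+ (- x i) _))

copies : ∀ {I} (n : ℕ) → I → Word I n
copies zero    i = nil
copies (suc n) i = add i (copies n i)

⟦⟧-copies : ∀ {I} n (i : I) (x : I → ℤ) → ⟦ copies n i ⟧ x ≡ + n * x i
⟦⟧-copies zero    i x = sym (ℤₚ.*-zeroˡ (x i))
⟦⟧-copies (suc n) i x = trans (cong (λ v → x i + v) (⟦⟧-copies n i x)) (sym (ℤₚ.suc-* (+ n) (x i)))

bind : ∀ {I J k l} → Word I k → (I → Word J l) → Word J (k ℕ.* l)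
bind nil       W = nil
bind (add i w) W = W i ⧺ bind w W
bind (sub i w) W = negateʷ (W i) ⧺ bind w W

⟦⟧-bind : ∀ {I J k l} H (w : Word I k) {W : I → Word J l} {z : I → ℤ} {x : J → ℤ} →
          (∀ i → H * z i ≡ ⟦ W i ⟧ x) → H * ⟦ w ⟧ z ≡ ⟦ bind w W ⟧ x
⟦⟧-bind H nil eq = ℤₚ.*-zeroʳ H
⟦⟧-bind H (add i w) {W} {z} {x} eq = trans (ℤₚ.*-distribˡ-+ H (z i) _)
  (trans (cong₂ _+_ (eq i) (⟦⟧-bind H w eq)) (sym (⟦⟧-⧺ (W i) _ x)))
⟦⟧-bind H (sub i w) {W} {z} {x} eq = trans (ℤₚ.*-distribˡ-+ H (- z i) _)
  (trans (cong₂ _+_ (trans (sym (ℤₚ.neg-distribʳ-* H (z i)))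
                           (trans (cong -_ (eq i)) (sym (⟦⟧-negate (W i) x))))
                    (⟦⟧-bind H w eq))
         (sym (⟦⟧-⧺ (negateʷ (W i)) _ x)))

-- Equivalence in Presburger arithmetic up to level s. Only homogeneous forms are tested; constants
-- are expressible only through a letter of value 1.
record Similar (s : ℕ) {I : Set} (x x' : I → ℤ) : Set where
  constructor similar
  field
    forth : (w : Word I s) → 0ℤ ≤ᶻ ⟦ w ⟧ x → 0ℤ ≤ᶻ ⟦ w ⟧ x'
    back : (w : Word I s) → 0ℤ ≤ᶻ ⟦ w ⟧ x' → 0ℤ ≤ᶻ ⟦ w ⟧ x
    residues : ∀ m → suc m ℕ.≤ s → ∀ i → + suc m ∣ x' i - x i
open Similar

Similar-refl : ∀ {s I} (x : I → ℤ) → Similar s x x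
Similar-refl x = similar (λ _ p → p) (λ _ p → p) λ m _ i → divides 0ℤ (ℤₚ.i≡j⇒i-j≡0 (refl {x = x i}))

Similar-sym : ∀ {s I} {x x' : I → ℤ} → Similar s x x' → Similar s x' x
Similar-sym {x = x} {x'} e = similar (back e) (forth e) λ m p i →
  subst (+ suc m ∣_) (lem (x' i) (x i)) (∣m⇒∣-m (residues e m p i))
  where lem : ∀ a b → - (a - b) ≡ b - a
        lem = solve-∀

Similar-trans : ∀ {s I} {x y z : I → ℤ} → Similar s x y → Similar s y z → Similar s x z
Similar-trans {x = x} {y} {z} e f = similar (λ w → forth f w ∘ forth e w) (λ w → back e w ∘ back f w) λ m p i →
  subst (+ suc m ∣_) (lem (z i) (y i) (x i)) (∣m∣n⇒∣m+n (residues f m p i) (residues e m p i))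
  where lem : ∀ a b c → (a - b) + (b - c) ≡ a - c
        lem = solve-∀

Similar-pull : ∀ {s I J} (f : I → J) {x x' : J → ℤ} {z z' : I → ℤ} →
         (∀ i → z i ≡ x (f i)) → (∀ i → z' i ≡ x' (f i)) → Similar s x x' → Similar s z z'
Similar-pull f eq eq' e = similar
  (λ w p → subst (0ℤ ≤ᶻ_) (sym (⟦⟧-map f w eq')) (forth e (mapʷ f w) (subst (0ℤ ≤ᶻ_) (⟦⟧-map f w eq) p)))
  (λ w p → subst (0ℤ ≤ᶻ_) (sym (⟦⟧-map f w eq)) (back e (mapʷ f w) (subst (0ℤ ≤ᶻ_) (⟦⟧-map f w eq') p)))
  λ m p i → subst₂ (λ a b → + suc m ∣ a - b) (sym (eq' i)) (sym (eq i)) (residues e m p (f i))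

Similar-mono : ∀ {s t I} {x x' : I → ℤ} → s ℕ.≤ t → Similar t x x' → Similar s x x'
Similar-mono {x = x} {x'} le e = similar
  (λ w p → subst (0ℤ ≤ᶻ_) (⟦⟧-weaken le w x') (forth e (weaken le w) (subst (0ℤ ≤ᶻ_) (sym (⟦⟧-weaken le w x)) p)))
  (λ w p → subst (0ℤ ≤ᶻ_) (⟦⟧-weaken le w x) (back e (weaken le w) (subst (0ℤ ≤ᶻ_) (sym (⟦⟧-weaken le w x')) p)))
  λ m p i → residues e m (ℕₚ.≤-trans p le) i

Similar-0 : ∀ {s I} {x x' : I → ℤ} → Similar s x x' → (w : Word I s) → ⟦ w ⟧ x ≡ 0ℤ → ⟦ w ⟧ x' ≡ 0ℤ
Similar-0 {x = x} {x'} e w eq = ℤₚ.≤-antisym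
  (ℤₚ.neg-cancel-≤ (subst (0ℤ ≤ᶻ_) (⟦⟧-negate w x')
    (forth e (negateʷ w) (ℤₚ.≤-reflexive (sym (trans (⟦⟧-negate w x) (cong -_ eq)))))))
  (forth e w (ℤₚ.≤-reflexive (sym eq)))

residues-word : ∀ {s I k} {x x' : I → ℤ} → Similar s x x' → ∀ m → suc m ℕ.≤ s → (w : Word I k) →
           + suc m ∣ ⟦ w ⟧ x' - ⟦ w ⟧ x
residues-word e m p nil = divides 0ℤ refl
residues-word {x = x} {x'} e m p (add i w) = subst (+ suc m ∣_) (lem (x' i) (x i) (⟦ w ⟧ x') (⟦ w ⟧ x))
  (∣m∣n⇒∣m+n (residues e m p i) (residues-word e m p w))
  where lem : ∀ a b c d → (a - b) + (c - d) ≡ (a + c) - (b + d)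
        lem = solve-∀
residues-word {x = x} {x'} e m p (sub i w) = subst (+ suc m ∣_) (lem (x' i) (x i) (⟦ w ⟧ x') (⟦ w ⟧ x))
  (∣m∣n⇒∣m+n (∣m⇒∣-m (residues e m p i)) (residues-word e m p w))
  where lem : ∀ a b c d → - (a - b) + (c - d) ≡ (- a + c) - (- b + d)
        lem = solve-∀

nonneg-scale : ∀ h {v} → 0ℤ ≤ᶻ v → 0ℤ ≤ᶻ + suc h * v
nonneg-scale h {v} p = subst (_≤ᶻ + suc h * v) (ℤₚ.*-zeroʳ (+ suc h)) (ℤₚ.*-monoˡ-≤-nonNeg (+ suc h) p)

nonneg-unscale : ∀ h {v} → 0ℤ ≤ᶻ + suc h * v → 0ℤ ≤ᶻ v
nonneg-unscale h {v} p = ℤₚ.*-cancelˡ-≤-pos 0ℤ v (+ suc h) (subst (_≤ᶻ + suc h * v) (sym (ℤₚ.*-zeroʳ (+ suc h))) p)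

-- Multiplying a form in z by `suc h` turns it into a form in x of the same sign, with ℓ letters for
-- each old one. Residues of z modulo m come from residues of `suc h` times z modulo `suc h` times
-- m, hence the second bound on t.
Similar-linear : ∀ {s t ℓ h I J} {x x' : J → ℤ} {z z' : I → ℤ} (W : I → Word J ℓ) →
           s ℕ.* ℓ ℕ.≤ t → suc h ℕ.* s ℕ.≤ t →
           (∀ i → + suc h * z i ≡ ⟦ W i ⟧ x) → (∀ i → + suc h * z' i ≡ ⟦ W i ⟧ x') →
           Similar t x x' → Similar s z z'
Similar-linear {s} {t} {ℓ} {h} {x = x} {x'} {z} {z'} W le le' eq eq' e = similar
  (λ w p → nonneg-unscale h (subst (0ℤ ≤ᶻ_) (sym (⟦⟧-bind (+ suc h) w eq'))
     (forth e₁ (bind w W) (subst (0ℤ ≤ᶻ_) (⟦⟧-bind (+ suc h) w eq) (nonneg-scale h p)))))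
  (λ w p → nonneg-unscale h (subst (0ℤ ≤ᶻ_) (sym (⟦⟧-bind (+ suc h) w eq))
     (back e₁ (bind w W) (subst (0ℤ ≤ᶻ_) (⟦⟧-bind (+ suc h) w eq') (nonneg-scale h p)))))
  λ m p i → *-cancelˡ-∣ (+ suc h) (subst₂ _∣_ (ℤₚ.pos-* (suc h) (suc m))
     (trans (cong₂ _-_ (sym (eq' i)) (sym (eq i))) (lem (+ suc h) (z' i) (z i)))
     (residues-word e (m ℕ.+ h ℕ.* suc m) (ℕₚ.≤-trans (ℕₚ.*-monoʳ-≤ (suc h) p) le') (W i)))
  where
  e₁ = Similar-mono le e
  lem : ∀ a b c → a * b - a * c ≡ a * (b - c)
  lem = solve-∀

-- Descent

infixr 5 _◂_
_◂_ : {I : Set} → ℤ → (I → ℤ) → Maybe I → ℤ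
y ◂ x = maybe′ x y

-- `len s` is the size of the word that a sign change yields: at most s letters from the form itself
-- and at most `s * s !` copies of the unit. Substituting such words into a form of s letters takes
-- `scale s`.
len scale : ℕ → ℕ
len s   = s ℕ.+ s ℕ.* (s !)
scale s = s ℕ.* len s

s≤len : ∀ s → s ℕ.≤ len s
s≤len s = ℕₚ.m≤m+n s _

s≤scale : ∀ s → s ℕ.≤ scale s
s≤scale zero    = z≤n
s≤scale (suc s) = ℕₚ.m≤m*n (suc s) (len (suc s))

-- `⟦ W ⟧ x'` has the residue of `⟦ W ⟧ x`, so it is again divisible by `suc h`. For the similarity,
-- each old letter is also read as a fraction with denominator `suc h`.
step : ∀ {s h J y} {x x' : J → ℤ} (W : Word J (len s)) → suc h ℕ.≤ s → Similar (scale s) x x' →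
       + suc h * y ≡ ⟦ W ⟧ x → Σ ℤ λ y' → + suc h * y' ≡ ⟦ W ⟧ x' × Similar s (y ◂ x) (y' ◂ x')
step {s} {h} {J} {y} {x} {x'} W h<s e eq
  with divides q qeq ← residues-word e h (ℕₚ.≤-trans h<s (s≤scale s)) W
  = y + q , eq' , Similar-linear {h = h} V ℕₚ.≤-refl (ℕₚ.≤-trans (ℕₚ.*-monoˡ-≤ s h<s) (ℕₚ.*-monoʳ-≤ s (s≤len s))) veq veq' e
  where
  lem : ∀ a b c → b ≡ (b - a) + a
  lem = solve-∀
  lem₂ : ∀ H y q → H * (y + q) ≡ q * H + H * y
  lem₂ = solve-∀
  eq' : + suc h * (y + q) ≡ ⟦ W ⟧ x'
  eq' = sym (trans (lem (⟦ W ⟧ x) (⟦ W ⟧ x') 0ℤ)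
             (trans (cong₂ _+_ qeq (sym eq)) (sym (lem₂ (+ suc h) y q))))
  h≤len = ℕₚ.≤-trans h<s (s≤len s)
  V : Maybe J → Word J (len s)
  V nothing  = W
  V (just j) = weaken h≤len (copies (suc h) j)
  copies-eq : ∀ (x : J → ℤ) j → + suc h * x j ≡ ⟦ weaken h≤len (copies (suc h) j) ⟧ x
  copies-eq x j = sym (trans (⟦⟧-weaken h≤len (copies (suc h) j) x) (⟦⟧-copies (suc h) j x))
  veq : ∀ i → + suc h * (y ◂ x) i ≡ ⟦ V i ⟧ x
  veq nothing  = eq
  veq (just j) = copies-eq x j
  veq' : ∀ i → + suc h * ((y + q) ◂ x') i ≡ ⟦ V i ⟧ x'
  veq' nothing  = eq'
  veq' (just j) = copies-eq x' j

coef : ∀ {I k} → Word (Maybe I) k → ℤ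
coef nil              = 0ℤ
coef (add nothing w)  = 1ℤ + coef w
coef (sub nothing w)  = - 1ℤ + coef w
coef (add (just i) w) = coef w
coef (sub (just i) w) = coef w

rest : ∀ {I k} → Word (Maybe I) k → Word I k
rest nil              = nil
rest (add nothing w)  = weaken (ℕₚ.n≤1+n _) (rest w)
rest (sub nothing w)  = weaken (ℕₚ.n≤1+n _) (rest w)
rest (add (just i) w) = add i (rest w)
rest (sub (just i) w) = sub i (rest w)

∣coef∣≤ : ∀ {I k} (w : Word (Maybe I) k) → ∣ coef w ∣ ℕ.≤ k
∣coef∣≤ nil              = z≤n
∣coef∣≤ (add nothing w)  = ℕₚ.≤-trans (ℤₚ.∣i+j∣≤∣i∣+∣j∣ 1ℤ (coef w)) (s≤s (∣coef∣≤ w))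
∣coef∣≤ (sub nothing w)  = ℕₚ.≤-trans (ℤₚ.∣i+j∣≤∣i∣+∣j∣ (- 1ℤ) (coef w)) (s≤s (∣coef∣≤ w))
∣coef∣≤ (add (just i) w) = ℕₚ.m≤n⇒m≤1+n (∣coef∣≤ w)
∣coef∣≤ (sub (just i) w) = ℕₚ.m≤n⇒m≤1+n (∣coef∣≤ w)

coef-rest : ∀ {I k} (w : Word (Maybe I) k) y (x : I → ℤ) →
            ⟦ w ⟧ (y ◂ x) ≡ coef w * y + ⟦ rest w ⟧ x
coef-rest nil y x = sym (trans (ℤₚ.+-identityʳ _) (ℤₚ.*-zeroˡ y))
coef-rest (add nothing w) y x =
  trans (cong (λ v → y + v) (coef-rest w y x))
        (trans (lem y (coef w) (⟦ rest w ⟧ x)) (cong (λ v → (1ℤ + coef w) * y + v) (sym (⟦⟧-weaken (ℕₚ.n≤1+n _) (rest w) x))))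
  where lem : ∀ y c r → y + (c * y + r) ≡ (1ℤ + c) * y + r
        lem = solve-∀
coef-rest (sub nothing w) y x =
  trans (cong (λ v → - y + v) (coef-rest w y x))
        (trans (lem y (coef w) (⟦ rest w ⟧ x)) (cong (λ v → (- 1ℤ + coef w) * y + v) (sym (⟦⟧-weaken (ℕₚ.n≤1+n _) (rest w) x))))
  where lem : ∀ y c r → - y + (c * y + r) ≡ (- 1ℤ + c) * y + r
        lem = solve-∀
coef-rest (add (just i) w) y x =
  trans (cong (λ v → x i + v) (coef-rest w y x)) (lem (x i) (coef w * y) (⟦ rest w ⟧ x))
  where lem : ∀ a b c → a + (b + c) ≡ b + (a + c)
        lem = solve-∀
coef-rest (sub (just i) w) y x =
  trans (cong (λ v → - x i + v) (coef-rest w y x)) (lem (- x i) (coef w * y) (⟦ rest w ⟧ x))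
  where lem : ∀ a b c → a + (b + c) ≡ b + (a + c)
        lem = solve-∀

Multiple : ∀ {I} → ℕ → (I → ℤ) → ℤ → Set
Multiple {I} s x y = Σ ℕ λ h → suc h ℕ.≤ s × Σ (Word I (len s)) λ W → + suc h * y ≡ ⟦ W ⟧ x

-- A step of `s !` changes the form by its coefficient of y times `s !`, at most `s * s !`. Its
-- value j at y is thus small enough to be written as j copies of the unit letter o, which turns the
-- sign change into an exact equation for a multiple of y.
crossing : ∀ {s I} {x : I → ℤ} {o} → x o ≡ 1ℤ → (w : Word (Maybe I) s) (y : ℤ) →
           0ℤ ≤ᶻ ⟦ w ⟧ (y ◂ x) → ⟦ w ⟧ (y - + (s !) ◂ x) ≤ᶻ 0ℤ →
           ⟦ w ⟧ (y - + (s !) ◂ x) < ⟦ w ⟧ (y ◂ x) → Multiple s x y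
crossing {s} {I} {x} {o} xo w y p p' lt with coef w | coef-rest w y x | coef-rest w (y - + (s !)) x | ∣coef∣≤ w
... | -[1+ h ] | eq | eq' | _ = ⊥-elim (ℤₚ.<⇒≱ lt (ℤₚ.0≤i-j⇒j≤i (subst (0ℤ ≤ᶻ_)
        (sym (trans (cong₂ _-_ eq' eq) (lem (-[1+ h ]) y (+ (s !)) (⟦ rest w ⟧ x)))) (nn h (s !)))))
  where lem : ∀ c y m r → (c * (y - m) + r) - (c * y + r) ≡ (- c) * m
        lem = solve-∀
        nn : ∀ h m → 0ℤ ≤ᶻ (+ suc h) * (+ m)
        nn h m = subst (0ℤ ≤ᶻ_) (ℤₚ.pos-* (suc h) m) (+≤+ z≤n)
... | + zero | eq | eq' | _ = ⊥-elim (ℤₚ.<-irrefl (trans eq' (trans (lem y (+ (s !)) (⟦ rest w ⟧ x)) (sym eq))) lt)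
  where lem : ∀ y m r → (0ℤ * (y - m) + r) ≡ (0ℤ * y + r)
        lem = solve-∀
... | + suc h | eq | eq' | h<s = h , h<s , weaken (ℕₚ.+-monoʳ-≤ s j≤) (negateʷ (rest w) ⧺ copies j o) ,
      sym (trans (⟦⟧-weaken (ℕₚ.+-monoʳ-≤ s j≤) (negateʷ (rest w) ⧺ copies j o) x)
          (trans (⟦⟧-⧺ (negateʷ (rest w)) (copies j o) x)
          (trans (cong₂ _+_ (⟦⟧-negate (rest w) x) (trans (⟦⟧-copies j o x) (trans (cong (+ j *_) xo)
                   (trans (ℤₚ.*-identityʳ (+ j)) (trans (ℤₚ.0≤i⇒+∣i∣≡i p) eq)))))
          (lem (+ suc h * y) (⟦ rest w ⟧ x)))))
  where
  j = ∣ ⟦ w ⟧ (y ◂ x) ∣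
  lem : ∀ a r → - r + (a + r) ≡ a
  lem = solve-∀
  lem₂ : ∀ c y m r → (c * y + r) ≡ c * m + (c * (y - m) + r)
  lem₂ = solve-∀
  t≤ : ⟦ w ⟧ (y ◂ x) ≤ᶻ + (suc h ℕ.* (s !))
  t≤ = subst₂ _≤ᶻ_ (sym (trans eq (trans (lem₂ (+ suc h) y (+ (s !)) (⟦ rest w ⟧ x))
                   (cong₂ _+_ (sym (ℤₚ.pos-* (suc h) (s !))) (sym eq')))))
              (ℤₚ.+-identityʳ _) (ℤₚ.+-monoʳ-≤ (+ (suc h ℕ.* (s !))) p')
  j≤ : j ℕ.≤ s ℕ.* (s !)
  j≤ = ℕₚ.≤-trans (ℤₚ.drop‿+≤+ (subst (_≤ᶻ _) (sym (ℤₚ.0≤i⇒+∣i∣≡i p)) t≤)) (ℕₚ.*-monoˡ-≤ (s !) h<s)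

-- P will be similarity over a possibly infinite alphabet, which is not decided; hence the double
-- negation.
first-failure : (P : ℕ → Set) → P 0 → ∀ n → ¬ P n → ¬ ¬ Σ ℕ λ k → P k × ¬ P (suc k)
first-failure P p0 zero    ¬p k = ¬p p0
first-failure P p0 (suc n) ¬p k = first-failure P p0 n (λ pn → k (n , pn , ¬p)) k

m∣s! : ∀ {m} s → suc m ℕ.≤ s → suc m ℕ∣.∣ s !
m∣s! (suc s) (s≤s p) with ℕₚ.m≤n⇒m<n∨m≡n p
... | inj₁ lt   = ℕ∣.∣n⇒∣m*n (suc s) (m∣s! s lt)
... | inj₂ refl = ℕ∣.m∣m*n (s !)

module Descent {s : ℕ} {I : Set} {x : I → ℤ} {o : I} (xo : x o ≡ 1ℤ) (y : ℤ) where

  down : ℕ → ℤ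
  down zero    = y
  down (suc k) = down k - + (s !)

  down-≤ : ∀ k → down k ≤ᶻ y - + k
  down-≤ zero    = ℤₚ.≤-reflexive (sym (ℤₚ.+-identityʳ y))
  down-≤ (suc k) = subst (down (suc k) ≤ᶻ_) (trans (lem y (+ k)) (cong (λ v → y - v) (sym (ℤₚ.pos-+ 1 k))))
      (ℤₚ.+-mono-≤ (down-≤ k) (ℤₚ.neg-mono-≤ (+≤+ (ℕₚ.1≤n! s))))
    where lem : ∀ y k → (y - k) + - 1ℤ ≡ y - (1ℤ + k)
          lem = solve-∀

  Good : ℕ → Set
  Good k = Similar s (y ◂ x) (down k ◂ x)

  crossing-at : ∀ k → Good k → ¬ Good (suc k) → ¬ ¬ Multiple s x (down k)
  crossing-at k g ¬g none = ¬g (similar up (λ w q → back g w (up' {w} q)) mods)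
    where
    keep : ∀ (w : Word (Maybe I) s) → 0ℤ ≤ᶻ ⟦ w ⟧ (down k ◂ x) → 0ℤ ≤ᶻ ⟦ w ⟧ (down (suc k) ◂ x)
    keep w p with 0ℤ ℤₚ.≤? ⟦ w ⟧ (down (suc k) ◂ x)
    ... | yes q = q
    ... | no ¬q = ⊥-elim (none (crossing xo w (down k) p (ℤₚ.<⇒≤ (ℤₚ.≰⇒> ¬q)) (ℤₚ.<-≤-trans (ℤₚ.≰⇒> ¬q) p)))
    up : ∀ w → 0ℤ ≤ᶻ ⟦ w ⟧ (y ◂ x) → 0ℤ ≤ᶻ ⟦ w ⟧ (down (suc k) ◂ x)
    up w p = keep w (forth g w p)
    neg-opp : ∀ (w : Word (Maybe I) s) z → z ≤ᶻ ⟦ w ⟧ (down (suc k) ◂ x) → ⟦ negateʷ w ⟧ (down (suc k) ◂ x) ≤ᶻ - z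
    neg-opp w z p = subst (_≤ᶻ - z) (sym (⟦⟧-negate w _)) (ℤₚ.neg-mono-≤ p)
    up' : ∀ {w} → 0ℤ ≤ᶻ ⟦ w ⟧ (down (suc k) ◂ x) → 0ℤ ≤ᶻ ⟦ w ⟧ (down k ◂ x)
    up' {w} p with 0ℤ ℤₚ.≤? ⟦ w ⟧ (down k ◂ x)
    ... | yes q = q
    -- A form that rises from negative to nonnegative is handled through its negative, which falls
    -- from positive to at most 0; for this `crossing` admits the value 0 after the step.
    ... | no ¬q = ⊥-elim (none (crossing xo (negateʷ w) (down k) (ℤₚ.<⇒≤ pos) (neg-opp w 0ℤ p)
                    (ℤₚ.≤-<-trans (neg-opp w 0ℤ p) pos)))
      where pos : 0ℤ < ⟦ negateʷ w ⟧ (down k ◂ x)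
            pos = subst (0ℤ <_) (sym (⟦⟧-negate w _)) (ℤₚ.neg-mono-< (ℤₚ.≰⇒> ¬q))
    mods : ∀ m → suc m ℕ.≤ s → ∀ i → + suc m ∣ (down (suc k) ◂ x) i - (y ◂ x) i
    mods m p (just i) = residues g m p (just i)
    mods m p nothing  = subst (+ suc m ∣_) (lem (down k) (+ (s !)) y)
      (∣m∣n⇒∣m+n (residues g m p nothing) (∣m⇒∣-m (∣ᵤ⇒∣ (m∣s! s p))))
      where lem : ∀ a b c → (a - c) + - b ≡ (a - b) - c
            lem = solve-∀

-- Lower y in steps of s!, which keeps all residues, until similarity breaks: then a linear form of
-- length at most s changes sign, so a multiple of the last good value is a short word in x.
descend : ∀ {s I} {x : I → ℤ} {o} → x o ≡ 1ℤ → 2 ℕ.≤ s → ∀ y i → 0ℤ ≤ᶻ y + x i →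
          ¬ ¬ Σ ℤ λ y₀ → Multiple s x y₀ × Similar s (y ◂ x) (y₀ ◂ x)
descend {s} {I} {x} xo 2≤s y i low none =
  first-failure Good (Similar-refl _) (suc ∣ y + x i ∣) too-low λ (k , g , ¬g) →
    crossing-at k g ¬g λ M → none (down k , M , g)
  where
  open Descent {x = x} xo y
  -- Each step lowers y by at least 1, so after K steps the form `y + x i` is negative and
  -- similarity has failed.
  K = suc ∣ y + x i ∣
  w : Word (Maybe I) 2
  w = add nothing (add (just i) nil)
  negative : down K + (x i + 0ℤ) < 0ℤ
  negative = ℤₚ.≤-<-trans (ℤₚ.+-monoˡ-≤ (x i + 0ℤ) (down-≤ K))
        (subst (_< 0ℤ) eq ℤ.-<+)
    where
    lem : ∀ a b → - 1ℤ ≡ ((a - (1ℤ + (a + b))) + (b + 0ℤ))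
    lem = solve-∀
    eq : - 1ℤ ≡ (y - + K) + (x i + 0ℤ)
    eq = trans (lem y (x i)) (cong (λ v → (y - v) + (x i + 0ℤ))
           (sym (trans (ℤₚ.pos-+ 1 ∣ y + x i ∣) (cong (λ v → 1ℤ + v) (ℤₚ.0≤i⇒+∣i∣≡i low)))))
  too-low : ¬ Good K
  too-low g = ℤₚ.<⇒≱ negative (forth (Similar-mono 2≤s g) w (subst (0ℤ ≤ᶻ_) (cong (λ v → y + v) (sym (ℤₚ.+-identityʳ (x i)))) low))

-- Codes

scale^ : ℕ → ℕ → ℕ
scale^ zero    s = s
scale^ (suc m) s = scale^ m (scale s)

-- A recipe for a tuple: each entry is a combination of the later ones and of the parameters, divided
-- by suc h.
data Code (I : Set) : ℕ → ℕ → Set where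
  done : ∀ {s} → Code I 0 s
  more : ∀ {m s} → Word (Fin m ⊎ I) (len s) → Fin s → Code I m (scale s) → Code I (suc m) s

Solves : ∀ {I m s} → Code I m s → (I → ℤ) → Vector ℤ m → Set
Solves done         x y = ⊤
Solves (more W h c) x y = + suc (toℕ h) * y zero ≡ ⟦ W ⟧ [ tail y , x ] × Solves c x (tail y)

front : ∀ {m} {I : Set} → Fin (suc m) ⊎ I → Maybe (Fin m ⊎ I)
front (inj₁ zero)    = nothing
front (inj₁ (suc i)) = just (inj₁ i)
front (inj₂ i)       = just (inj₂ i)

front-eq : ∀ {m} {I : Set} (y : Vector ℤ (suc m)) (x : I → ℤ) i →
           [ y , x ] i ≡ (y zero ◂ [ tail y , x ]) (front i)
front-eq y x (inj₁ zero)    = refl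
front-eq y x (inj₁ (suc i)) = refl
front-eq y x (inj₂ i)       = refl

Similar-front : ∀ {m s} {I : Set} {y y' : Vector ℤ (suc m)} {x x' : I → ℤ} →
          Similar s (y zero ◂ [ tail y , x ]) (y' zero ◂ [ tail y' , x' ]) → Similar s [ y , x ] [ y' , x' ]
Similar-front {y = y} {y'} {x} {x'} = Similar-pull front (front-eq y x) (front-eq y' x')

-- The first entry descends over the old tail. The tail is then replaced at level `scale s`, which
-- leaves enough similarity for `step` to solve the equation of the first entry over the new tail.
realize : ∀ {m s I} {x : I → ℤ} {o} → x o ≡ 1ℤ → 2 ℕ.≤ s → (y : Vector ℤ m) →
          (∀ j → Σ I λ i → 0ℤ ≤ᶻ y j + x i) →
          ¬ ¬ Σ (Vector ℤ m) λ y₀ → Σ (Code I m s) λ c → Solves c x y₀ × Similar s [ y , x ] [ y₀ , x ]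
realize {zero} xo 2≤s y low none = none (y , done , tt , Similar-refl _)
realize {suc m} {s} {I} {x} xo 2≤s y low none =
  descend {x = [ tail y , x ]} {inj₂ _} xo 2≤s (y zero) (inj₂ (proj₁ (low zero))) (proj₂ (low zero))
    λ (z , (h , h<s , W , eq) , e) →
  realize {s = scale s} xo (ℕₚ.≤-trans 2≤s (s≤scale s)) (tail y) (low ∘ suc) λ (y₀ , c , d , e') →
  let (z' , eq' , e'') = step W h<s e' eq in
  none (z' ∷ᶠ y₀ , more W (fromℕ< h<s) c ,
        (trans (cong (λ k → + suc k * z') (Finₚ.toℕ-fromℕ< h<s)) eq' , d) ,
        Similar-front (Similar-trans e e''))

-- The code uses only letters in the image of f, but the resulting similarity is over all of J. The
-- surplus letters will be powers whose exponents are chosen later.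
transfer : ∀ {m s I J} {x x' : J → ℤ} (f : I → J) (c : Code I m s) → Similar (scale^ m s) x x' →
           ∀ {y} → Solves c (x ∘ f) y →
           Σ (Vector ℤ m) λ y' → Solves c (x' ∘ f) y' × Similar s [ y , x ] [ y' , x' ]
transfer {J = J} {x} {x'} f done e {y} _ = y , tt , Similar-pull drop eq eq' e
  where
  drop : Fin 0 ⊎ J → J
  drop (inj₂ j) = j
  eq : ∀ i → [ y , x ] i ≡ x (drop i)
  eq (inj₂ j) = refl
  eq' : ∀ i → [ y , x' ] i ≡ x' (drop i)
  eq' (inj₂ j) = refl
transfer {suc m} {s} {x = x} {x'} f (more W h c) e {y} (eq , d) =
  let (y' , d' , e')  = transfer f c e d
      (z , eq' , e'') = step (mapʷ (Sum.map id f) W) (Finₚ.toℕ<n h) e' (trans eq (⟦⟧-map (Sum.map id f) W (along (tail y) x)))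
  in z ∷ᶠ y' , (trans eq' (sym (⟦⟧-map (Sum.map id f) W (along y' x'))) , d') , Similar-front e''
  where
  along : ∀ y x i → [ y , x ∘ f ] i ≡ [ y , x ] (Sum.map id f i)
  along y x (inj₁ i) = refl
  along y x (inj₂ i) = refl

-- The denominators are nonzero, so the entries are determined from the last to the first. Counting
-- codes thus bounds the number of tuples.
Solves-unique : ∀ {m s I} {x x' : I → ℤ} (c : Code I m s) → (∀ i → x i ≡ x' i) → ∀ {y y'} →
             Solves c x y → Solves c x' y' → ∀ j → y j ≡ y' j
Solves-unique {x = x} {x'} (more W h c) xeq {y} {y'} (eq , d) (eq' , d') = go
  where
  ys : ∀ j → tail y j ≡ tail y' j
  ys = Solves-unique c xeq d d'
  both : ∀ i → [ tail y , x ] i ≡ [ tail y' , x' ] i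
  both (inj₁ i) = ys i
  both (inj₂ i) = xeq i
  go : ∀ j → y j ≡ y' j
  go zero    = ℤₚ.*-cancelˡ-≡ (+ suc (toℕ h)) (y zero) (y' zero) (trans eq (trans (⟦⟧-cong W both) (sym eq')))
  go (suc j) = ys j

mapᶜ : ∀ {m s I J} → (I → J) → Code I m s → Code J m s
mapᶜ f done         = done
mapᶜ f (more W h c) = more (mapʷ (Sum.map id f) W) h (mapᶜ f c)

Solves-map : ∀ {m s I J} (f : I → J) (c : Code I m s) {x : I → ℤ} {x' : J → ℤ} → (∀ i → x i ≡ x' (f i)) →
          ∀ {y} → Solves c x y → Solves (mapᶜ f c) x' y
Solves-map f done eq d = tt
Solves-map f (more W h c) {x} {x'} eq {y} (e , d) = trans e (⟦⟧-map _ W along) , Solves-map f c eq d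
  where
  along : ∀ i → [ tail y , x ] i ≡ [ tail y , x' ] (Sum.map id f i)
  along (inj₁ i) = refl
  along (inj₂ i) = eq i

-- The number of exponents that suffice to write all the powers of D used by a code.
letters : ℕ → ℕ → ℕ
letters zero    s = 0
letters (suc m) s = len s ℕ.+ letters m (scale s)

private
  shift : ∀ {m k} {A : Set} → Fin m ⊎ (A ⊎ Fin k) → Fin m ⊎ (A ⊎ Fin (suc k))
  shift = Sum.map id (Sum.map id suc)

  shift-eq : ∀ {m k} {A : Set} (y : Vector ℤ m) (u : A → ℤ) (g : ℕ → ℤ) n (η : Fin k → ℕ) i →
             [ y , [ u , g ∘ η ] ] i ≡ [ y , [ u , g ∘ (n ∷ᶠ η) ] ] (shift i)
  shift-eq y u g n η (inj₁ i)        = refl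
  shift-eq y u g n η (inj₂ (inj₁ i)) = refl
  shift-eq y u g n η (inj₂ (inj₂ i)) = refl

localize-letter : ∀ {m k} {A : Set} (i : Fin m ⊎ (A ⊎ ℕ)) → Σ ℕ λ n → Σ (Fin m ⊎ (A ⊎ Fin (suc k))) λ i' →
                  ∀ (y : Vector ℤ m) (u : A → ℤ) (g : ℕ → ℤ) (η : Fin k → ℕ) →
                  [ y , [ u , g ] ] i ≡ [ y , [ u , g ∘ (n ∷ᶠ η) ] ] i'
localize-letter (inj₁ j)        = 0 , inj₁ j , λ _ _ _ _ → refl
localize-letter (inj₂ (inj₁ a)) = 0 , inj₂ (inj₁ a) , λ _ _ _ _ → refl
localize-letter (inj₂ (inj₂ n)) = n , inj₂ (inj₂ zero) , λ _ _ _ _ → refl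

localizeʷ : ∀ {m k} {A : Set} (W : Word (Fin m ⊎ (A ⊎ ℕ)) k) →
            Σ (Fin k → ℕ) λ η → Σ (Word (Fin m ⊎ (A ⊎ Fin k)) k) λ W' →
            ∀ (y : Vector ℤ m) (u : A → ℤ) (g : ℕ → ℤ) →
            ⟦ W ⟧ [ y , [ u , g ] ] ≡ ⟦ W' ⟧ [ y , [ u , g ∘ η ] ]
localizeʷ nil = (λ _ → 0) , nil , λ _ _ _ → refl
localizeʷ (add i W) with localizeʷ W | localize-letter i
... | η , W' , eq | n , i' , ieq = n ∷ᶠ η , add i' (mapʷ shift W') , λ y u g →
  cong₂ _+_ (ieq y u g η) (trans (eq y u g) (⟦⟧-map shift W' (shift-eq y u g n η)))
localizeʷ (sub i W) with localizeʷ W | localize-letter i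
... | η , W' , eq | n , i' , ieq = n ∷ᶠ η , sub i' (mapʷ shift W') , λ y u g →
  cong₂ (λ a b → ℤ.- a + b) (ieq y u g η) (trans (eq y u g) (⟦⟧-map shift W' (shift-eq y u g n η)))

-- With a letter for each power of D there are infinitely many codes. Moving the exponents into η
-- leaves a code in which finitely many slots stand for powers; such codes can be counted, and their
-- slots filled with other exponents.
localize : ∀ {m s} {A : Set} (c : Code (A ⊎ ℕ) m s) →
           Σ (Fin (letters m s) → ℕ) λ η → Σ (Code (A ⊎ Fin (letters m s)) m s) λ c' →
           ∀ {y u} {g : ℕ → ℤ} → Solves c [ u , g ] y → Solves c' [ u , g ∘ η ] y
localize done = (λ ()) , done , λ _ → tt
localize {suc m} {s} {A} (more W h c) with localizeʷ W | localize c
... | η , W' , weq | θ , c' , ceq =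
  η ++ θ ,
  more (mapʷ left W') h (mapᶜ right c') ,
  λ {y} {u} {g} (e , d) →
    trans e (trans (weq (tail y) u g) (⟦⟧-map left W' (left-eq (tail y) u g))) ,
    Solves-map right c' (right-eq u g) (ceq d)
  where
  k = len s
  l = letters m (scale s)
  left : Fin m ⊎ (A ⊎ Fin k) → Fin m ⊎ (A ⊎ Fin (k ℕ.+ l))
  left = Sum.map id (Sum.map id (_↑ˡ l))
  right : A ⊎ Fin l → A ⊎ Fin (k ℕ.+ l)
  right = Sum.map id (k ↑ʳ_)
  left-eq : ∀ y u (g : ℕ → ℤ) i → [ y , [ u , g ∘ η ] ] i ≡ [ y , [ u , g ∘ (η ++ θ) ] ] (left i)
  left-eq y u g (inj₁ i)        = refl
  left-eq y u g (inj₂ (inj₁ i)) = refl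
  left-eq y u g (inj₂ (inj₂ i)) = cong g (sym (Vecₚ.lookup-++ˡ η θ i))
  right-eq : ∀ u (g : ℕ → ℤ) i → [ u , g ∘ θ ] i ≡ [ u , g ∘ (η ++ θ) ] (right i)
  right-eq u g (inj₁ i) = refl
  right-eq u g (inj₂ i) = cong g (sym (Vecₚ.lookup-++ʳ η θ i))

-- Powers with coupled exponents

Solves-cong : ∀ {m s I} (c : Code I m s) {x x' : I → ℤ} {y y' : Vector ℤ m} →
           (∀ i → x i ≡ x' i) → (∀ j → y j ≡ y' j) → Solves c x y → Solves c x' y'
Solves-cong done xeq yeq d = tt
Solves-cong (more W h c) {x} {x'} {y} {y'} xeq yeq (e , d) =
  trans (cong (λ v → + suc (toℕ h) * v) (sym (yeq zero))) (trans e (⟦⟧-cong W both)) ,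
  Solves-cong c xeq (yeq ∘ suc) d
  where
  both : ∀ i → [ tail y , x ] i ≡ [ tail y' , x' ] i
  both (inj₁ i) = yeq (suc i)
  both (inj₂ i) = xeq i

with-unit : {K : Set} → (K → ℕ) → Maybe K → ℤ
with-unit e = 1ℤ ◂ (+_ ∘ e)

Similarᵉ : ℕ → {K : Set} → (K → ℕ) → (K → ℕ) → Set
Similarᵉ σ e e' = Similar σ (with-unit e) (with-unit e')

power : ℕ → ℕ → ℤ
power D ε = + (D ^ ε)

-- u and u' satisfy the same constraints with powers of D whenever the exponents η and η' of these
-- satisfy the same Presburger constraints over e and e'.
Coupled : ℕ → ℕ → ℕ → {A K : Set} → (A → ℤ) → (A → ℤ) → (K → ℕ) → (K → ℕ) → Set₁
Coupled D s σ u u' e e' = ∀ {J : Set} (η η' : J → ℕ) → Similarᵉ σ [ e , η ] [ e' , η' ] →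
                    Similar s [ u , power D ∘ η ] [ u' , power D ∘ η' ]

n≤D^n : ∀ {D} → 2 ℕ.≤ D → ∀ n → suc n ℕ.≤ D ^ n
n≤D^n 2≤D zero    = s≤s z≤n
n≤D^n {D} 2≤D (suc n) = ℕₚ.≤-trans
  (ℕₚ.≤-trans (s≤s (s≤s (ℕₚ.m≤m+n n _))) (ℕₚ.≤-reflexive (cong suc (sym (ℕₚ.+-suc n _)))))
  (ℕₚ.*-mono-≤ 2≤D (n≤D^n 2≤D n))

-- The descent is reused with exponents as the integers and e as the parameters: `realize` over e,
-- then `transfer` to e'.
extend-exponents : ∀ L {τ} {K : Set} {e e' : K → ℕ} → 2 ℕ.≤ τ → Similarᵉ (scale^ L τ) e e' → (ε : Vector ℕ L) →
  ¬ ¬ Σ (Vector ℕ L) λ ε' → Σ (Code (Maybe K) L τ) λ c →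
      Solves c (with-unit e') (+_ ∘ ε') × Similarᵉ τ [ e , ε ] [ e' , ε' ]
extend-exponents L {τ} {K} {e} {e'} 2≤τ ee ε none =
  realize {x = with-unit e} {nothing} refl 2≤τ (+_ ∘ ε) (λ j → nothing , +≤+ z≤n) λ (y₀ , c , d , e₀) →
  let (y' , d' , e₁) = transfer id c ee d
      e₂ = Similar-trans e₀ e₁
      -- Nonnegativity is a one-letter sign condition, so the answers are natural numbers again.
      nonneg : ∀ j → 0ℤ ≤ᶻ y' j
      nonneg j = subst (0ℤ ≤ᶻ_) (ℤₚ.+-identityʳ (y' j))
        (forth (Similar-mono (ℕₚ.≤-trans (s≤s z≤n) 2≤τ) e₂) (add {k = 0} (inj₁ j) nil) (+≤+ z≤n))
      abs : ∀ j → + ∣ y' j ∣ ≡ y' j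
      abs j = ℤₚ.0≤i⇒+∣i∣≡i (nonneg j)
      eq' : ∀ i → with-unit [ e' , (∣_∣ ∘ y') ] i ≡ [ y' , with-unit e' ] (swap i)
      eq' = λ { nothing → refl ; (just (inj₁ k)) → refl ; (just (inj₂ j)) → abs j }
  in none (∣_∣ ∘ y' , c , Solves-cong c (λ _ → refl) (λ j → sym (abs j)) d' , Similar-pull swap eq eq' e₂)
  where
  swap : Maybe (K ⊎ Fin L) → Fin L ⊎ Maybe K
  swap nothing         = inj₂ nothing
  swap (just (inj₁ k)) = inj₂ (just k)
  swap (just (inj₂ j)) = inj₁ j
  eq : ∀ i → with-unit [ e , ε ] i ≡ [ +_ ∘ ε , with-unit e ] (swap i)
  eq nothing         = refl
  eq (just (inj₁ k)) = refl
  eq (just (inj₂ j)) = refl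

Similarᵉ-pull : ∀ {σ} {K K' : Set} (f : K' → K) {e e' : K → ℕ} {z z' : K' → ℕ} →
          (∀ i → z i ≡ e (f i)) → (∀ i → z' i ≡ e' (f i)) → Similarᵉ σ e e' → Similarᵉ σ z z'
Similarᵉ-pull f eq eq' = Similar-pull (Maybe.map f)
  (λ { nothing → refl ; (just k) → cong +_ (eq k) }) (λ { nothing → refl ; (just k) → cong +_ (eq' k) })

Coupled-pull : ∀ {D s σ} {A A' K : Set} (f : A' → A) {u u' : A → ℤ} {v v' : A' → ℤ} {e e' : K → ℕ} →
         (∀ i → v i ≡ u (f i)) → (∀ i → v' i ≡ u' (f i)) → Coupled D s σ u u' e e' → Coupled D s σ v v' e e'
Coupled-pull f eq eq' r η η' ee = Similar-pull (Sum.map f id)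
  (λ { (inj₁ i) → eq i ; (inj₂ j) → refl }) (λ { (inj₁ i) → eq' i ; (inj₂ j) → refl }) (r η η' ee)

-- A move on the tuple y. Its code over u and the powers of D mentions exponents ε; these are
-- answered by ε' over e', and y' solves the same code over u' and the powers with exponents ε'.
Coupled-step : ∀ {D m s σ τ} {A K : Set} {u u' : A → ℤ} {e e' : K → ℕ} →
  2 ℕ.≤ D → 2 ℕ.≤ s → 2 ℕ.≤ τ → σ ℕ.≤ τ → Similarᵉ (scale^ (letters m s) τ) e e' →
  Coupled D (scale^ m s) σ u u' e e' → (y : Vector ℤ m) →
  ¬ ¬ Σ (Vector ℤ m) λ y' → Σ (Vector ℕ (letters m s)) λ ε → Σ (Vector ℕ (letters m s)) λ ε' →
      Σ (Code (A ⊎ Fin (letters m s)) m s) λ zc → Σ (Code (Maybe K) (letters m s) τ) λ xc →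
      Solves xc (with-unit e') (+_ ∘ ε') × Solves zc [ u' , power D ∘ ε' ] y' ×
      Similarᵉ τ [ e , ε ] [ e' , ε' ] × Coupled D s σ [ y , u ] [ y' , u' ] [ e , ε ] [ e' , ε' ]
Coupled-step {D} {m} {s} {σ} {τ} {A} {K} {u} {u'} {e} {e'} 2≤D 2≤s 2≤τ σ≤τ ee r y none =
  -- `D ^ 0` serves as the unit letter.
  realize {x = [ u , power D ]} {inj₂ 0} refl 2≤s y low λ (y₀ , c , d , e₀) →
  let (ε , zc , loc) = localize c
      zd = loc {u = u} {power D} d
  in extend-exponents L 2≤τ ee ε λ (ε' , xc , xd , ee') →
  let (y' , zd' , _) = transfer id zc (r ε ε' (Similar-mono σ≤τ ee')) zd
  in none (y' , ε , ε' , zc , xc , xd , zd' , ee' , λ {J} η η' eη → extended e₀ zd zd' η η' eη)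
  where
  L = letters m s
  low : ∀ j → Σ (A ⊎ ℕ) λ i → 0ℤ ≤ᶻ y j + [ u , power D ] i
  -- `D ^ ∣ y j ∣` exceeds `∣ y j ∣`, so a power of D stops the descent.
  low j = inj₂ ∣ y j ∣ , ℤₚ.≤-trans (nn (y j))
      (ℤₚ.+-monoʳ-≤ (y j) (+≤+ (ℕₚ.<⇒≤ (n≤D^n 2≤D ∣ y j ∣))))
    where
    nn : ∀ z → 0ℤ ≤ᶻ z + + ∣ z ∣
    nn (+ n)      = +≤+ z≤n
    nn (ℤ.-[1+ n ]) = ℤₚ.≤-reflexive (sym (ℤₚ.+-inverseˡ (+ suc n)))
  extended : ∀ {y₀ y' ε ε'} {zc : Code (A ⊎ Fin L) m s} →
    Similar s [ y , [ u , power D ] ] [ y₀ , [ u , power D ] ] →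
    Solves zc [ u , power D ∘ ε ] y₀ → Solves zc [ u' , power D ∘ ε' ] y' →
    Coupled D s σ [ y , u ] [ y' , u' ] [ e , ε ] [ e' , ε' ]
  extended {y₀} {y'} {ε} {ε'} {zc} e₀ zd zd' {J} η η' eη =
    -- The old coupling applies to ε and η together, so the code can be solved anew next to η'. By
    -- uniqueness the solution is y', which was chosen before η and η'.
    let big = r [ ε , η ] [ ε' , η' ] (Similarᵉ-pull assoc assoc-eq assoc-eq eη)
        (y″ , zd″ , e₁) = transfer emb zc big (Solves-cong zc (emb-eq u ε η) (λ _ → refl) zd)
        same = Solves-unique zc (λ i → sym (emb-eq u' ε' η' i)) zd″ zd'
    in Similar-trans (Similar-pull old (old-eq y) (old-eq y₀) e₀)
               (Similar-pull new (new-eq u ε η) (λ i → trans (new-eq′ same i) (new-eq u' ε' η' i)) e₁)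
    where
    assoc : K ⊎ (Fin L ⊎ J) → (K ⊎ Fin L) ⊎ J
    assoc (inj₁ k)        = inj₁ (inj₁ k)
    assoc (inj₂ (inj₁ i)) = inj₁ (inj₂ i)
    assoc (inj₂ (inj₂ j)) = inj₂ j
    assoc-eq : ∀ {e : K → ℕ} {ε : Fin L → ℕ} {η : J → ℕ} i → [ e , [ ε , η ] ] i ≡ [ [ e , ε ] , η ] (assoc i)
    assoc-eq (inj₁ k)        = refl
    assoc-eq (inj₂ (inj₁ i)) = refl
    assoc-eq (inj₂ (inj₂ j)) = refl
    emb : A ⊎ Fin L → A ⊎ (Fin L ⊎ J)
    emb = Sum.map id inj₁
    emb-eq : ∀ u ε (η : J → ℕ) i → [ u , power D ∘ ε ] i ≡ [ u , power D ∘ [ ε , η ] ] (emb i)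
    emb-eq u ε η (inj₁ a) = refl
    emb-eq u ε η (inj₂ i) = refl
    old : (Fin m ⊎ A) ⊎ J → Fin m ⊎ (A ⊎ ℕ)
    old (inj₁ (inj₁ i)) = inj₁ i
    old (inj₁ (inj₂ a)) = inj₂ (inj₁ a)
    old (inj₂ j)        = inj₂ (inj₂ (η j))
    old-eq : ∀ z i → [ [ z , u ] , power D ∘ η ] i ≡ [ z , [ u , power D ] ] (old i)
    old-eq z (inj₁ (inj₁ i)) = refl
    old-eq z (inj₁ (inj₂ a)) = refl
    old-eq z (inj₂ j)        = refl
    new : (Fin m ⊎ A) ⊎ J → Fin m ⊎ (A ⊎ (Fin L ⊎ J))
    new (inj₁ (inj₁ i)) = inj₁ i
    new (inj₁ (inj₂ a)) = inj₂ (inj₁ a)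
    new (inj₂ j)        = inj₂ (inj₂ (inj₂ j))
    new-eq : ∀ u ε (η : J → ℕ) {z} i → [ [ z , u ] , power D ∘ η ] i ≡ [ z , [ u , power D ∘ [ ε , η ] ] ] (new i)
    new-eq u ε η (inj₁ (inj₁ i)) = refl
    new-eq u ε η (inj₁ (inj₂ a)) = refl
    new-eq u ε η (inj₂ j)        = refl
    new-eq′ : ∀ {z z'} → (∀ j → z j ≡ z' j) → ∀ i →
              [ [ z' , u' ] , power D ∘ η' ] i ≡ [ [ z , u' ] , power D ∘ η' ] i
    new-eq′ eq (inj₁ (inj₁ i)) = sym (eq i)
    new-eq′ eq (inj₁ (inj₂ a)) = refl
    new-eq′ eq (inj₂ j)        = refl

-- Truth of formulas

Similar-≡ : ∀ {s k l I} {x x' : I → ℤ} → Similar s x x' → (v : Word I k) (w : Word I l) → k ℕ.+ l ℕ.≤ s →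
       ⟦ v ⟧ x ≡ ⟦ w ⟧ x → ⟦ v ⟧ x' ≡ ⟦ w ⟧ x'
Similar-≡ {x = x} {x'} e v w le eq = ℤₚ.i-j≡0⇒i≡j _ _ (trans (sym (diff x'))
  (Similar-0 (Similar-mono le e) (v ⧺ negateʷ w) (trans (diff x) (ℤₚ.i≡j⇒i-j≡0 eq))))
  where
  diff : ∀ x → ⟦ v ⧺ negateʷ w ⟧ x ≡ ⟦ v ⟧ x - ⟦ w ⟧ x
  diff x = trans (⟦⟧-⧺ v (negateʷ w) x) (cong (λ z → ⟦ v ⟧ x + z) (⟦⟧-negate w x))

Coupled-sym : ∀ {D s σ} {A K : Set} {u u' : A → ℤ} {e e' : K → ℕ} → Coupled D s σ u u' e e' → Coupled D s σ u' u e' e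
Coupled-sym r η η' ee = Similar-sym (r η' η (Similar-sym ee))

Coupled-mono : ∀ {D s t σ} {A K : Set} {u u' : A → ℤ} {e e' : K → ℕ} → s ℕ.≤ t → Coupled D t σ u u' e e' → Coupled D s σ u u' e e'
Coupled-mono le r η η' ee = Similar-mono le (r η η' ee)

-- For d = 1 the only power is the power of 2 with exponent 0, so the base 2 serves as well.
data Base : ℕ → ℕ → Set where
  itself : ∀ {d} → 2 ℕ.≤ d → Base d d
  two    : Base 1 2

2≤base : ∀ {d D} → Base d D → 2 ℕ.≤ D
2≤base (itself p) = p
2≤base two        = ℕₚ.≤-refl

InPow⇒ : ∀ {d D x} → Base d D → InPow d x → Σ ℕ λ ε → (d ≡ 1 → ε ≡ 0) × x ≡ power D ε
InPow⇒ (itself 2≤d) (k , eq) = k , (λ { refl → ⊥-elim (ℕₚ.1+n≰n 2≤d) }) , eq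
InPow⇒ two          (k , eq) = 0 , (λ _ → refl) , trans eq (cong +_ (ℕₚ.^-zeroˡ k))

⇒InPow : ∀ {d D x} → Base d D → ∀ ε → (d ≡ 1 → ε ≡ 0) → x ≡ power D ε → InPow d x
⇒InPow (itself _) ε adm eq = ε , eq
⇒InPow two        ε adm eq = 0 , trans eq (cong (power 2) (adm refl))

^-injective : ∀ {D} → 2 ℕ.≤ D → ∀ {m n} → D ^ m ≡ D ^ n → m ≡ n
^-injective {D} 2≤D {m} {n} eq with ℕₚ.<-cmp m n
... | tri< lt _ _ = ⊥-elim (ℕₚ.<-irrefl eq (ℕₚ.^-monoʳ-< D 2≤D lt))
... | tri≈ _ e _  = e
... | tri> _ _ gt = ⊥-elim (ℕₚ.<-irrefl (sym eq) (ℕₚ.^-monoʳ-< D 2≤D gt))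

power-+ : ∀ D m n → power D (m ℕ.+ n) ≡ power D m * power D n
power-+ D m n = trans (cong +_ (ℕₚ.^-distribˡ-+-* D m n)) (ℤₚ.pos-* (D ^ m) (D ^ n))

size : ∀ {n} → Term n → ℕ
size (var i)    = 1
size (plus s t) = size s ℕ.+ size t

word : ∀ {n} {J : Set} (t : Term n) → Word (Fin n ⊎ J) (size t)
word (var i)    = add (inj₁ i) nil
word (plus s t) = word s ⧺ word t

⟦word⟧ : ∀ {n} {J : Set} (t : Term n) (u : Vector ℤ n) (g : J → ℤ) → ⟦ word t ⟧ [ u , g ] ≡ evalT u t
⟦word⟧ (var i)    u g = ℤₚ.+-identityʳ (u i)
⟦word⟧ (plus s t) u g = trans (⟦⟧-⧺ (word s) (word t) [ u , g ]) (cong₂ _+_ (⟦word⟧ s u g) (⟦word⟧ t u g))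

Sat-stable : ∀ {d n} (φ : Formula n) {u : Vector ℤ n} → ¬ ¬ Sat d u φ → Sat d u φ
Sat-stable falsum      h = h id
Sat-stable (equal s t) h = λ k → h λ f → f k
Sat-stable (pow t)     h = λ k → h λ f → f k
Sat-stable (mul s t v) h = λ k → h λ f → f k
Sat-stable (neg φ)     h = λ k → h λ f → f k
Sat-stable (conj φ ψ)  h = Sat-stable φ (λ k → h (k ∘ proj₁)) , Sat-stable ψ (λ k → h (k ∘ proj₂))
Sat-stable (disj φ ψ)  h = λ k → h λ f → f k
Sat-stable (impl φ ψ)  h = λ p → Sat-stable ψ λ k → h λ f → k (f p)
Sat-stable (all φ)     h = λ x → Sat-stable φ λ k → h λ f → k (f x)
Sat-stable (ex φ)      h = λ k → h λ f → f k

scaleᶠ : ∀ {n} → Formula n → ℕ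
scaleᶠ falsum      = 2
scaleᶠ (equal s t) = size s ℕ.+ size t
scaleᶠ (pow t)     = size t ℕ.+ 1
scaleᶠ (mul s t v) = (size s ℕ.+ 1) ℕ.+ ((size t ℕ.+ 1) ℕ.+ (size v ℕ.+ 1))
scaleᶠ (neg φ)     = scaleᶠ φ
scaleᶠ (conj φ ψ)  = scaleᶠ φ ℕ.+ scaleᶠ ψ
scaleᶠ (disj φ ψ)  = scaleᶠ φ ℕ.+ scaleᶠ ψ
scaleᶠ (impl φ ψ)  = scaleᶠ φ ℕ.+ scaleᶠ ψ
scaleᶠ (all φ)     = scale^ 1 (2 ℕ.+ scaleᶠ φ)
scaleᶠ (ex φ)      = scale^ 1 (2 ℕ.+ scaleᶠ φ)

strengthᶠ : ∀ {n} → Formula n → ℕ → ℕ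
strengthᶠ falsum      σ = 0
strengthᶠ (equal s t) σ = 3 ℕ.+ σ
strengthᶠ (pow t)     σ = scale^ 1 (3 ℕ.+ σ)
strengthᶠ (mul s t v) σ = scale^ 3 (3 ℕ.+ σ)
strengthᶠ (neg φ)     σ = strengthᶠ φ σ
strengthᶠ (conj φ ψ)  σ = strengthᶠ φ σ ℕ.+ strengthᶠ ψ σ
strengthᶠ (disj φ ψ)  σ = strengthᶠ φ σ ℕ.+ strengthᶠ ψ σ
strengthᶠ (impl φ ψ)  σ = strengthᶠ φ σ ℕ.+ strengthᶠ ψ σ
strengthᶠ (all φ)     σ = scale^ (letters 1 (2 ℕ.+ scaleᶠ φ)) (2 ℕ.+ (σ ℕ.+ strengthᶠ φ σ))
strengthᶠ (ex φ)      σ = scale^ (letters 1 (2 ℕ.+ scaleᶠ φ)) (2 ℕ.+ (σ ℕ.+ strengthᶠ φ σ))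

module Invariance {d D : ℕ} (base : Base d D) where

  exponents : ∀ T {n s σ τ} {K : Set} {u u' : Vector ℤ n} {e e' : K → ℕ} → scale^ T (3 ℕ.+ σ) ℕ.≤ τ →
    Similarᵉ τ e e' → Coupled D s σ u u' e e' → (ε : Vector ℕ T) →
    ¬ ¬ Σ (Vector ℕ T) λ ε' → Similarᵉ (3 ℕ.+ σ) [ e , ε ] [ e' , ε' ] × Similar s [ u , power D ∘ ε ] [ u' , power D ∘ ε' ]
  exponents T {σ = σ} le ee r ε none =
    extend-exponents T (s≤s (s≤s z≤n)) (Similar-mono le ee) ε λ (ε' , _ , _ , ee') →
      none (ε' , ee' , r ε ε' (Similar-mono (ℕₚ.m≤n+m σ 3) ee'))

  -- For d = 1 the exponent must remain 0, a one-letter equation on exponents.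
  admissible : ∀ {T σ} {K : Set} {e e' : K → ℕ} {ε ε' : Vector ℕ T} →
    Similarᵉ (3 ℕ.+ σ) [ e , ε ] [ e' , ε' ] → ∀ j → (d ≡ 1 → ε j ≡ 0) → d ≡ 1 → ε' j ≡ 0
  admissible {σ = σ} {ε = ε} {ε'} ee j adm d≡1 = ℤₚ.+-injective (trans (sym (ℤₚ.+-identityʳ _))
    (Similar-≡ ee (add {k = 0} (just (inj₂ j)) nil) (nil {k = 0}) (s≤s z≤n)
      (trans (ℤₚ.+-identityʳ _) (cong +_ (adm d≡1)))))

  power-transfer : ∀ {n T s} {u u' : Vector ℤ n} (ε ε' : Vector ℕ T) (t : Term n) → size t ℕ.+ 1 ℕ.≤ s →
    Similar s [ u , power D ∘ ε ] [ u' , power D ∘ ε' ] → ∀ j → evalT u t ≡ power D (ε j) → evalT u' t ≡ power D (ε' j)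
  power-transfer {u = u} {u'} ε ε' t le e j eq = trans (sym (⟦word⟧ t u' _))
    (trans (Similar-≡ e (word t) (add {k = 0} (inj₂ j) nil) le (trans (⟦word⟧ t u _) (trans eq (sym (ℤₚ.+-identityʳ _)))))
           (ℤₚ.+-identityʳ _))

  extend : ∀ {n s₀ σ τ₀ s τ} {K : Set} {u u' : Vector ℤ n} {e e' : K → ℕ} →
    scale^ 1 (2 ℕ.+ s₀) ℕ.≤ s → scale^ (letters 1 (2 ℕ.+ s₀)) (2 ℕ.+ (σ ℕ.+ τ₀)) ℕ.≤ τ →
    Similarᵉ τ e e' → Coupled D s σ u u' e e' → ∀ x →
    ¬ ¬ Σ ℤ λ x' → Σ (Vector ℕ (letters 1 (2 ℕ.+ s₀))) λ ε → Σ (Vector ℕ (letters 1 (2 ℕ.+ s₀))) λ ε' →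
        Similarᵉ τ₀ [ e , ε ] [ e' , ε' ] × Coupled D s₀ σ (x ∷ᶠ u) (x' ∷ᶠ u') [ e , ε ] [ e' , ε' ]
  extend {n} {s₀} {σ} {τ₀} {u = u} {u'} sle τle ee r x none =
    Coupled-step {m = 1} {s = 2 ℕ.+ s₀} (2≤base base) (s≤s (s≤s z≤n)) (s≤s (s≤s z≤n))
      (ℕₚ.≤-trans (ℕₚ.m≤m+n σ τ₀) (ℕₚ.m≤n+m _ 2)) (Similar-mono τle ee) (Coupled-mono sle r) (λ _ → x)
      λ (y' , ε , ε' , _ , _ , _ , _ , ee' , r') →
    none (y' zero , ε , ε' , Similar-mono (ℕₚ.≤-trans (ℕₚ.m≤n+m τ₀ σ) (ℕₚ.m≤n+m _ 2)) ee' ,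
      Coupled-mono (ℕₚ.m≤n+m s₀ 2) (Coupled-pull front′ (front′-eq u (λ _ → x)) (front′-eq u' y') r'))
    where
    front′ : Fin (suc n) → Fin 1 ⊎ Fin n
    front′ zero    = inj₁ zero
    front′ (suc i) = inj₂ i
    front′-eq : ∀ u (y : Vector ℤ 1) i → (y zero ∷ᶠ u) i ≡ [ y , u ] (front′ i)
    front′-eq u y zero    = refl
    front′-eq u y (suc i) = refl

  -- An Ehrenfeucht-Fraisse induction. Both relations are symmetric, which gives negations, premises
  -- of implications and the moves that start from u'.
  invariant : ∀ {n} (φ : Formula n) {s σ τ} {K : Set} {u u' : Vector ℤ n} {e e' : K → ℕ} →
    scaleᶠ φ ℕ.≤ s → strengthᶠ φ σ ℕ.≤ τ → Similarᵉ τ e e' → Coupled D s σ u u' e e' → Sat d u φ → Sat d u' φ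
  invariant falsum zle ele ee r p = p
  invariant (equal s t) {u = u} {u'} zle ele ee r p none = p λ eq →
    exponents 0 ele ee r []ᶠ λ (_ , _ , e) → none
      (trans (sym (⟦word⟧ s u' _)) (trans (Similar-≡ e (word s) (word t) zle
        (trans (⟦word⟧ s u _) (trans eq (sym (⟦word⟧ t u _))))) (⟦word⟧ t u' _)))
  invariant (pow t) {u = u} {u'} zle ele ee r p none = p λ inp →
    let (ε , adm , eq) = InPow⇒ base inp in
    exponents 1 ele ee r (ε ∷ᶠ []ᶠ) λ (ε' , ee' , e) → none
      (⇒InPow base (ε' zero) (admissible ee' zero adm) (power-transfer (ε ∷ᶠ []ᶠ) ε' t zle e zero eq))
  invariant (mul s t v) {s = S} {u = u} {u'} zle ele ee r p none = p λ (inps , inpt , inpv , eq) →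
    let (α , admα , eqα) = InPow⇒ base inps
        (β , admβ , eqβ) = InPow⇒ base inpt
        (γ , admγ , eqγ) = InPow⇒ base inpv
        -- Here multiplication becomes a linear form of three letters in the exponents.
        α+β≡γ : α ℕ.+ β ≡ γ
        α+β≡γ = ^-injective (2≤base base) (ℤₚ.+-injective
          (trans (power-+ D α β) (trans (sym (cong₂ _*_ eqα eqβ)) (trans eq eqγ))))
        εs = α ∷ᶠ β ∷ᶠ γ ∷ᶠ []ᶠ
    in exponents 3 ele ee r εs λ (ε' , ee' , e) →
    let eqs = power-transfer εs ε' s les e zero eqα
        eqt = power-transfer εs ε' t let′ e (suc zero) eqβ
        eqv = power-transfer εs ε' v lev e (suc (suc zero)) eqγ
        sum : ε' zero ℕ.+ ε' (suc zero) ≡ ε' (suc (suc zero))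
        sum = ℤₚ.+-injective (trans (flat (ε' zero) (ε' (suc zero)))
                (trans (Similar-≡ ee' v₂ v₁ (s≤s (s≤s (s≤s z≤n)))
                  (trans (sym (flat α β)) (trans (cong +_ α+β≡γ) (sym (ℤₚ.+-identityʳ _)))))
                  (ℤₚ.+-identityʳ _)))
    in none (⇒InPow base _ (admissible ee' zero admα) eqs ,
             ⇒InPow base _ (admissible ee' (suc zero) admβ) eqt ,
             ⇒InPow base _ (admissible ee' (suc (suc zero)) admγ) eqv ,
             trans (cong₂ _*_ eqs eqt) (trans (sym (power-+ D (ε' zero) (ε' (suc zero)))) (trans (cong (power D) sum) (sym eqv))))
    where
    les = ℕₚ.m+n≤o⇒m≤o (size s ℕ.+ 1) zle
    ler = ℕₚ.m+n≤o⇒n≤o (size s ℕ.+ 1) zle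
    let′ = ℕₚ.m+n≤o⇒m≤o (size t ℕ.+ 1) ler
    lev = ℕₚ.m+n≤o⇒n≤o (size t ℕ.+ 1) ler
    v₂ : ∀ {K : Set} → Word (Maybe (K ⊎ Fin 3)) 2
    v₂ = add (just (inj₂ zero)) (add (just (inj₂ (suc zero))) nil)
    v₁ : ∀ {K : Set} → Word (Maybe (K ⊎ Fin 3)) 1
    v₁ = add (just (inj₂ (suc (suc zero)))) nil
    flat : ∀ a b → + (a ℕ.+ b) ≡ + a + (+ b + 0ℤ)
    flat a b = trans (ℤₚ.pos-+ a b) (cong (λ z → + a + z) (sym (ℤₚ.+-identityʳ (+ b))))
  invariant (neg φ) zle ele ee r p q = p (invariant φ zle ele (Similar-sym ee) (Coupled-sym r) q)
  invariant (conj φ ψ) {σ = σ} zle ele ee r (p , q) =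
    invariant φ (ℕₚ.m+n≤o⇒m≤o (scaleᶠ φ) zle) (ℕₚ.m+n≤o⇒m≤o (strengthᶠ φ σ) ele) ee r p ,
    invariant ψ (ℕₚ.m+n≤o⇒n≤o (scaleᶠ φ) zle) (ℕₚ.m+n≤o⇒n≤o (strengthᶠ φ σ) ele) ee r q
  invariant (disj φ ψ) {σ = σ} zle ele ee r h (¬p , ¬q) = h
    ( (λ p → ¬p (invariant φ (ℕₚ.m+n≤o⇒m≤o (scaleᶠ φ) zle) (ℕₚ.m+n≤o⇒m≤o (strengthᶠ φ σ) ele) ee r p))
    , (λ q → ¬q (invariant ψ (ℕₚ.m+n≤o⇒n≤o (scaleᶠ φ) zle) (ℕₚ.m+n≤o⇒n≤o (strengthᶠ φ σ) ele) ee r q)))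
  invariant (impl φ ψ) {σ = σ} zle ele ee r f p =
    invariant ψ (ℕₚ.m+n≤o⇒n≤o (scaleᶠ φ) zle) (ℕₚ.m+n≤o⇒n≤o (strengthᶠ φ σ) ele) ee r
      (f (invariant φ (ℕₚ.m+n≤o⇒m≤o (scaleᶠ φ) zle) (ℕₚ.m+n≤o⇒m≤o (strengthᶠ φ σ) ele) (Similar-sym ee) (Coupled-sym r) p))
  invariant (all φ) zle ele ee r f x' = Sat-stable φ λ none →
    extend zle ele (Similar-sym ee) (Coupled-sym r) x' λ (x , ε' , ε , ee' , r') →
      none (invariant φ ℕₚ.≤-refl ℕₚ.≤-refl (Similar-sym ee') (Coupled-sym r') (f x))
  invariant (ex φ) zle ele ee r h none = h λ x p →
    extend zle ele ee r x λ (x' , ε , ε' , ee' , r') →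
      none x' (invariant φ ℕₚ.≤-refl ℕₚ.≤-refl ee' r' p)

-- Signs of sums of powers

dominated⁺ : ∀ X Y → ∣ X ∣ ℕ.< ∣ Y ∣ → 0ℤ ≤ᶻ X + Y → 0ℤ ≤ᶻ Y
dominated⁺ X (+ n)    lt p = +≤+ z≤n
dominated⁺ X -[1+ n ] lt p = ⊥-elim (ℤₚ.<⇒≱ negative p)
  where
  ≤∣∣ : ∀ i → i ≤ᶻ + ∣ i ∣
  ≤∣∣ (+ m)    = ℤₚ.≤-refl
  ≤∣∣ -[1+ m ] = ℤ.-≤+
  negative : X + -[1+ n ] < 0ℤ
  negative = ℤₚ.≤-<-trans (ℤₚ.+-monoˡ-≤ -[1+ n ] (≤∣∣ X))
          (subst (+ ∣ X ∣ + -[1+ n ] <_) (ℤₚ.+-inverseʳ (+ suc n)) (ℤₚ.+-monoˡ-< -[1+ n ] (ℤ.+<+ lt)))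

dominated⁻ : ∀ X Y → ∣ X ∣ ℕ.< ∣ Y ∣ → 0ℤ ≤ᶻ Y → 0ℤ ≤ᶻ X + Y
dominated⁻ (+ m)    (+ n) lt p = +≤+ z≤n
dominated⁻ -[1+ m ] (+ n) lt p = subst (0ℤ ≤ᶻ_) (ℤₚ.+-comm (+ n) -[1+ m ]) (ℤₚ.i≤j⇒0≤j-i (+≤+ (ℕₚ.<⇒≤ lt)))

module Exponents {K : Set} {e e' : K → ℕ} where

  shift-≤ : ∀ {σ} c k l → 2 ℕ.+ c ℕ.≤ σ → Similarᵉ σ e e' → e k ℕ.+ c ℕ.≤ e l → e' k ℕ.+ c ℕ.≤ e' l
  shift-≤ c k l le ee p = ℤₚ.drop‿+≤+ (ℤₚ.0≤i-j⇒j≤i (subst (0ℤ ≤ᶻ_) (value e')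
      (forth (Similar-mono le ee) w (subst (0ℤ ≤ᶻ_) (sym (value e)) (ℤₚ.i≤j⇒0≤j-i (+≤+ p))))))
    where
    w = add (just l) (sub (just k) (negateʷ (copies c nothing)))
    lem : ∀ a b c → a + (- b + - (c * 1ℤ)) ≡ a - (b + c)
    lem = solve-∀
    value : ∀ e → ⟦ w ⟧ (with-unit e) ≡ + e l - + (e k ℕ.+ c)
    value e = trans (cong (λ z → + e l + (- + e k + z)) (trans (⟦⟧-negate (copies c nothing) (with-unit e)) (cong -_ (⟦⟧-copies c nothing (with-unit e)))))
             (trans (lem (+ e l) (+ e k) (+ c)) (cong (λ z → + e l - z) (sym (ℤₚ.pos-+ (e k) c))))

  ≤-shift : ∀ {σ} c k l → 2 ℕ.+ c ℕ.≤ σ → Similarᵉ σ e e' → e k ℕ.≤ e l ℕ.+ c → e' k ℕ.≤ e' l ℕ.+ c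
  ≤-shift c k l le ee p = ℤₚ.drop‿+≤+ (ℤₚ.0≤i-j⇒j≤i (subst (0ℤ ≤ᶻ_) (value e')
      (forth (Similar-mono le ee) w (subst (0ℤ ≤ᶻ_) (sym (value e)) (ℤₚ.i≤j⇒0≤j-i (+≤+ p))))))
    where
    w = add (just l) (sub (just k) (copies c nothing))
    lem : ∀ a b c → a + (- b + c * 1ℤ) ≡ (a + c) - b
    lem = solve-∀
    value : ∀ e → ⟦ w ⟧ (with-unit e) ≡ + (e l ℕ.+ c) - + e k
    value e = trans (cong (λ z → + e l + (- + e k + z)) (⟦⟧-copies c nothing (with-unit e)))
             (trans (lem (+ e l) (+ e k) (+ c)) (cong (λ z → z - + e k) (sym (ℤₚ.pos-+ (e l) c))))

  shift-≡ : ∀ {σ} c k l → 2 ℕ.+ c ℕ.≤ σ → Similarᵉ σ e e' → e l ≡ e k ℕ.+ c → e' l ≡ e' k ℕ.+ c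
  shift-≡ c k l le ee eq = ℕₚ.≤-antisym (≤-shift c l k le ee (ℕₚ.≤-reflexive eq))
                                        (shift-≤ c k l le ee (ℕₚ.≤-reflexive (sym eq)))

open Exponents

module PowerSums (D : ℕ) (2≤D : 2 ℕ.≤ D) where

  1≤D^ : ∀ n → 1 ℕ.≤ D ^ n
  1≤D^ n = ℕₚ.≤-trans (s≤s z≤n) (n≤D^n 2≤D n)

  D^-mono : ∀ {m n} → m ℕ.≤ n → D ^ m ℕ.≤ D ^ n
  D^-mono {m} {n} le = ℕₚ.^-monoʳ-≤ D {{ℕ.>-nonZero (ℕₚ.≤-trans (s≤s z≤n) 2≤D)}} le

  log-exists : ∀ n → Σ ℕ λ ℓ → D ^ ℓ ℕ.≤ suc n × suc n ℕ.< D ^ suc ℓ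
  log-exists zero = 0 , s≤s z≤n , ℕₚ.≤-trans 2≤D (ℕₚ.≤-reflexive (sym (ℕₚ.*-identityʳ D)))
  log-exists (suc n) with log-exists n
  ... | ℓ , le , lt with suc (suc n) ℕ.<? D ^ suc ℓ
  ...   | yes q = ℓ , ℕₚ.m≤n⇒m≤1+n le , q
  ...   | no ¬q = suc ℓ , ℕₚ.≮⇒≥ ¬q , ℕₚ.≤-<-trans lt (ℕₚ.^-monoʳ-< D 2≤D (ℕₚ.n<1+n (suc ℓ)))

  log : ℤ → ℕ
  -- A default: for v = 0 the leading power alone decides the sign.
  log (+ zero)  = 0
  log (+ suc n) = proj₁ (log-exists n)
  log -[1+ n ]  = proj₁ (log-exists n)

  log-spec : ∀ v → v ≡ 0ℤ ⊎ D ^ log v ℕ.≤ ∣ v ∣ × ∣ v ∣ ℕ.< D ^ suc (log v)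
  log-spec (+ zero)  = inj₁ refl
  log-spec (+ suc n) = inj₂ (proj₂ (log-exists n))
  log-spec -[1+ n ]  = inj₂ (proj₂ (log-exists n))

  val : ∀ {K : Set} {n} → (K → ℕ) → Vec (ℤ × K) n → ℤ
  val e []            = 0ℤ
  val e ((f , k) ∷ T) = f * power D (e k) + val e T

  Bounded : ∀ {K : Set} {n} → ℕ → Vec (ℤ × K) n → Set
  Bounded F = All λ t → ∣ proj₁ t ∣ ℕ.≤ F

  pick-max : ∀ {K : Set} {n F} (e : K → ℕ) (T : Vec (ℤ × K) (suc n)) → Bounded F T →
    Σ (ℤ × K) λ t → Σ (Vec (ℤ × K) n) λ T' → (∀ e → val e T ≡ val e (t ∷ T')) ×
      Bounded F (t ∷ T') × All (λ s → e (proj₂ s) ℕ.≤ e (proj₂ t)) T'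
  pick-max e (t ∷ []) b = t , [] , (λ _ → refl) , b , []
  pick-max e (t ∷ T@(_ ∷ _)) (bt ∷ b) with pick-max e T b
  ... | m , T' , eq , bm ∷ b' , max with e (proj₂ t) ℕ.≤? e (proj₂ m)
  ...   | yes q = m , t ∷ T' , (λ e → trans (cong (λ z → proj₁ t * power D (e (proj₂ t)) + z) (eq e))
                    (lem (proj₁ t * power D (e (proj₂ t))) (proj₁ m * power D (e (proj₂ m))) (val e T'))) ,
                  bm ∷ bt ∷ b' , q ∷ max
    where lem : ∀ a b c → a + (b + c) ≡ b + (a + c)
          lem = solve-∀
  ...   | no ¬q = t , m ∷ T' , (λ e → cong (λ z → proj₁ t * power D (e (proj₂ t)) + z) (eq e)) ,
                  bt ∷ bm ∷ b' , ℕₚ.≰⇒≥ ¬q ∷ All.map (λ p → ℕₚ.≤-trans p (ℕₚ.≰⇒≥ ¬q)) max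

  -- Either a term within C of the maximal exponent k can be combined with (f , k), or k dominates.
  merge : ∀ {K : Set} {e e' : K → ℕ} {n F σ} C f k → 2 ℕ.+ C ℕ.≤ σ → Similarᵉ σ e e' → ∣ f ∣ ℕ.≤ F →
    (T : Vec (ℤ × K) n) → Bounded F T → All (λ s → e (proj₂ s) ℕ.≤ e k) T →
    All (λ s → e (proj₂ s) ℕ.+ C ℕ.< e k) T ⊎
    Σ (Vec (ℤ × K) n) λ T' → val e ((f , k) ∷ T) ≡ val e T' × val e' ((f , k) ∷ T) ≡ val e' T' ×
      Bounded (F ℕ.+ F ℕ.* D ^ C) T'
  merge C f k le ee bf [] [] [] = inj₁ []
  merge {e = e} {e'} {F = F} {σ} C f k le ee bf ((g , l) ∷ T) (bg ∷ b) (m ∷ max) with e l ℕ.+ C ℕ.<? e k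
  -- Similarity fixes differences of exponents up to C, so c is also the difference under e', and
  -- `(f , k)` joins the term at l with the factor `D ^ c`.
  ... | no ¬q = inj₂ ((g + f * power D c , l) ∷ T , vals e kl , vals e' kl' , bound ∷ All.map (λ p → ℕₚ.≤-trans p (ℕₚ.m≤m+n F _)) b)
    where
    c = e k ℕ.∸ e l
    kl : e k ≡ e l ℕ.+ c
    kl = sym (ℕₚ.m+[n∸m]≡n m)
    c≤C : c ℕ.≤ C
    c≤C = ℕₚ.m≤n+o⇒m∸n≤o (e k) (e l) (ℕₚ.≮⇒≥ ¬q)
    kl' : e' k ≡ e' l ℕ.+ c
    kl' = shift-≡ c l k (ℕₚ.≤-trans (s≤s (s≤s c≤C)) le) ee kl
    lem : ∀ f g p q v → f * (p * q) + (g * p + v) ≡ (g + f * q) * p + v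
    lem = solve-∀
    vals : ∀ e → e k ≡ e l ℕ.+ c → val e ((f , k) ∷ (g , l) ∷ T) ≡ val e ((g + f * power D c , l) ∷ T)
    vals e eq = trans (cong (λ z → f * z + (g * power D (e l) + val e T)) (trans (cong (power D) eq) (power-+ D (e l) c)))
                      (lem f g (power D (e l)) (power D c) (val e T))
    bound : ∣ g + f * power D c ∣ ℕ.≤ F ℕ.+ F ℕ.* D ^ C
    bound = ℕₚ.≤-trans (ℤₚ.∣i+j∣≤∣i∣+∣j∣ g (f * power D c)) (ℕₚ.+-mono-≤ bg
      (ℕₚ.≤-trans (ℕₚ.≤-reflexive (ℤₚ.abs-* f (power D c))) (ℕₚ.*-mono-≤ bf (D^-mono c≤C))))
  ... | yes q with merge C f k le ee bf T b max
  ...   | inj₁ far = inj₁ (q ∷ far)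
  ...   | inj₂ (T' , eq , eq' , b') = inj₂ ((g , l) ∷ T' , vals eq , vals eq' , ℕₚ.≤-trans bg (ℕₚ.m≤m+n F _) ∷ b')
    where
    lem : ∀ a b c → a + (b + c) ≡ b + (a + c)
    lem = solve-∀
    vals : ∀ {e} → val e ((f , k) ∷ T) ≡ val e T' → val e ((f , k) ∷ (g , l) ∷ T) ≡ val e ((g , l) ∷ T')
    vals {e} eq = trans (lem (f * power D (e k)) (g * power D (e l)) (val e T)) (cong (λ z → g * power D (e l) + z) eq)

  estimate : ∀ {K : Set} {n F} C N (e : K → ℕ) (T : Vec (ℤ × K) n) → Bounded F T →
    All (λ s → e (proj₂ s) ℕ.+ C ℕ.≤ N) T → ∣ val e T ∣ ℕ.* D ^ C ℕ.≤ (n ℕ.* F) ℕ.* D ^ N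
  estimate C N e [] [] [] = z≤n
  estimate {n = suc n} {F} C N e ((f , k) ∷ T) (bf ∷ b) (le ∷ les) = begin
    ∣ f * power D (e k) + val e T ∣ ℕ.* D ^ C
      ≤⟨ ℕₚ.*-monoˡ-≤ (D ^ C) (ℤₚ.∣i+j∣≤∣i∣+∣j∣ (f * power D (e k)) (val e T)) ⟩
    (∣ f * power D (e k) ∣ ℕ.+ ∣ val e T ∣) ℕ.* D ^ C
      ≡⟨ ℕₚ.*-distribʳ-+ (D ^ C) ∣ f * power D (e k) ∣ ∣ val e T ∣ ⟩
    ∣ f * power D (e k) ∣ ℕ.* D ^ C ℕ.+ ∣ val e T ∣ ℕ.* D ^ C
      ≡⟨ cong (λ z → z ℕ.* D ^ C ℕ.+ ∣ val e T ∣ ℕ.* D ^ C) (ℤₚ.abs-* f (power D (e k))) ⟩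
    ∣ f ∣ ℕ.* D ^ e k ℕ.* D ^ C ℕ.+ ∣ val e T ∣ ℕ.* D ^ C
      ≡⟨ cong (ℕ._+ ∣ val e T ∣ ℕ.* D ^ C) (trans (ℕₚ.*-assoc ∣ f ∣ (D ^ e k) (D ^ C)) (cong (∣ f ∣ ℕ.*_) (sym (ℕₚ.^-distribˡ-+-* D (e k) C)))) ⟩
    ∣ f ∣ ℕ.* D ^ (e k ℕ.+ C) ℕ.+ ∣ val e T ∣ ℕ.* D ^ C
      ≤⟨ ℕₚ.+-mono-≤ (ℕₚ.*-mono-≤ bf (D^-mono le)) (estimate C N e T b les) ⟩
    F ℕ.* D ^ N ℕ.+ (n ℕ.* F) ℕ.* D ^ N
      ≡⟨ sym (ℕₚ.*-distribʳ-+ (D ^ N) F (n ℕ.* F)) ⟩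
    (suc n ℕ.* F) ℕ.* D ^ N ∎
    where open ℕₚ.≤-Reasoning

  -- `D ^ gap r F` exceeds `gap r F`, hence both `1 + r * F` and `suc r * F`: the weight of v and r
  -- lower terms against the leading power, and of r + 1 terms against v. `bound r F` limits a
  -- coefficient after two terms at distance at most the gap have merged.
  gap bound : ℕ → ℕ → ℕ
  gap r F   = suc r ℕ.* F ℕ.+ 1
  bound r F = F ℕ.+ F ℕ.* D ^ gap r F

  strength : ℕ → ℕ → ℕ
  strength zero    F = 0
  strength (suc r) F = (3 ℕ.+ gap r F) ℕ.+ strength r (bound r F)

  -- The exponents at which the sign of v + Σ fᵢ D^eᵢ (r terms, ∣fᵢ∣ ≤ F) can change are the logarithms
  -- of v and of the values obtained from v by absorbing terms of nearly the same size; a path says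
  -- which terms are absorbed.
  Path : ℕ → ℕ → Set
  Path zero    F = ⊥
  Path (suc r) F = ⊤ ⊎ (Path r (bound r F) ⊎ (Fin (suc (F ℕ.+ F)) × (Fin (suc (gap r F ℕ.+ gap r F)) × Path r (bound r F))))

  threshold : ∀ r F → ℤ → Path r F → ℕ
  threshold (suc r) F v (inj₁ tt)                   = log v
  threshold (suc r) F v (inj₂ (inj₁ p))             = threshold r (bound r F) v p
  threshold (suc r) F v (inj₂ (inj₂ (a , g , p))) =
    -- The finite types encode signed ranges: a stands for a coefficient between -F and F, and g for
    -- an exponent within the gap of `log v`.
    threshold r (bound r F) (v + (+ toℕ a - + F) * power D ((log v ℕ.+ toℕ g) ℕ.∸ gap r F)) p

  -- Thresholds occur among the exponents with the same value on both sides, so similarity preserves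
  -- comparisons with them.
  Contains : ∀ {K P : Set} → (K → ℕ) → (K → ℕ) → (P → ℕ) → Set
  Contains {K} {P} e e' x = ∀ p → Σ K λ k → e k ≡ x p × e' k ≡ x p

  scaled-< : ∀ {a b C N} → a ℕ.* D ^ C ℕ.≤ b ℕ.* D ^ N → b ℕ.< D ^ C → a ℕ.< D ^ N
  scaled-< {a} {b} {C} {N} le lt = ℕₚ.*-cancelʳ-< (D ^ C) a (D ^ N) (ℕₚ.≤-<-trans le
    (subst (b ℕ.* D ^ N ℕ.<_) (ℕₚ.*-comm (D ^ C) (D ^ N)) (ℕₚ.*-monoˡ-< (D ^ N) {{ℕ.>-nonZero (1≤D^ N)}} lt)))

  leading : ∀ {K : Set} {r n F} v f (k : K) (e : K → ℕ) (T : Vec (ℤ × K) n) → n ℕ.≤ r → ¬ f ≡ 0ℤ →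
    Bounded F T → ∣ v ∣ ℕ.* D ^ gap r F ℕ.≤ D ^ e k → All (λ s → e (proj₂ s) ℕ.+ gap r F ℕ.< e k) T →
    ∣ v + val e T ∣ ℕ.< ∣ f * power D (e k) ∣
  leading {r = r} {n} {F} v f k e T n≤r f≢0 b small far = ℕₚ.<-≤-trans
    (ℕₚ.≤-<-trans (ℤₚ.∣i+j∣≤∣i∣+∣j∣ v (val e T)) (scaled-< {b = 1 ℕ.+ n ℕ.* F} {C} {e k}
      (begin
        (∣ v ∣ ℕ.+ ∣ val e T ∣) ℕ.* D ^ C              ≡⟨ ℕₚ.*-distribʳ-+ (D ^ C) ∣ v ∣ ∣ val e T ∣ ⟩
        ∣ v ∣ ℕ.* D ^ C ℕ.+ ∣ val e T ∣ ℕ.* D ^ C      ≤⟨ ℕₚ.+-mono-≤ small (estimate C (e k) e T b (All.map ℕₚ.<⇒≤ far)) ⟩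
        D ^ e k ℕ.+ (n ℕ.* F) ℕ.* D ^ e k              ∎)
      (ℕₚ.≤-trans (s≤s (ℕₚ.≤-trans (ℕₚ.≤-reflexive (ℕₚ.+-comm 1 (n ℕ.* F)))
        (ℕₚ.+-monoˡ-≤ 1 (ℕₚ.*-monoˡ-≤ F (ℕₚ.m≤n⇒m≤1+n n≤r))))) (n≤D^n 2≤D C))))
    (ℕₚ.≤-trans (ℕₚ.≤-trans (ℕₚ.≤-reflexive (sym (ℕₚ.*-identityˡ (D ^ e k))))
       (ℕₚ.*-monoˡ-≤ (D ^ e k) (nonzero f f≢0))) (ℕₚ.≤-reflexive (sym (ℤₚ.abs-* f (power D (e k))))))
    where
    open ℕₚ.≤-Reasoning
    C = gap r F
    nonzero : ∀ f → ¬ f ≡ 0ℤ → 1 ℕ.≤ ∣ f ∣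
    nonzero (+ zero)  ne = ⊥-elim (ne refl)
    nonzero (+ suc _) ne = s≤s z≤n
    nonzero -[1+ _ ]  ne = s≤s z≤n

  trailing : ∀ {K : Set} {r n F} v N (e : K → ℕ) (T : Vec (ℤ × K) n) → n ℕ.≤ suc r → Bounded F T →
    D ^ N ℕ.≤ ∣ v ∣ → All (λ s → e (proj₂ s) ℕ.+ gap r F ℕ.≤ N) T → ∣ val e T ∣ ℕ.< ∣ v ∣
  trailing {r = r} {n} {F} v N e T n≤r b le les = ℕₚ.<-≤-trans
    (scaled-< {b = n ℕ.* F} {gap r F} {N} (estimate (gap r F) N e T b les)
      (ℕₚ.≤-<-trans (ℕₚ.≤-trans (ℕₚ.*-monoˡ-≤ F n≤r) (ℕₚ.m≤m+n (suc r ℕ.* F) 1)) (n≤D^n 2≤D (gap r F)))) le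

  pos-coef : ∀ f a b → 0ℤ ≤ᶻ f * power D a → 0ℤ ≤ᶻ f * power D b
  pos-coef (+ n)    a b p = subst (0ℤ ≤ᶻ_) (ℤₚ.pos-* n (D ^ b)) (+≤+ z≤n)
  pos-coef -[1+ n ] a b p = ⊥-elim (ℤₚ.<⇒≱ negative p)
    where
    negative : -[1+ n ] * power D a < 0ℤ
    negative = subst (-[1+ n ] * power D a <_) (ℤₚ.*-zeroˡ (power D a)) (ℤₚ.*-monoʳ-<-pos (power D a) {{ℤ.positive (ℤ.+<+ (1≤D^ a))}} { -[1+ n ]} {0ℤ} ℤ.-<+)

  -- Induction on the number of terms, by the term `(f , k)` of maximal exponent. If another term is
  -- near, the two merge; if f is 0, it drops out; if v is 0, the sign of f decides. Otherwise `e k`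
  -- is compared with `log v`: far above, the sign of f decides; far below, that of v; within the
  -- gap, `e k` and `e' k` coincide and the term is absorbed into v.
  sign-transfer : ∀ r F v {K : Set} {e e' : K → ℕ} {n} → n ℕ.≤ r → Contains e e' (threshold r F v) →
    Similarᵉ (strength r F) e e' → (T : Vec (ℤ × K) n) → Bounded F T → 0ℤ ≤ᶻ v + val e T → 0ℤ ≤ᶻ v + val e' T
  sign-transfer r F v n≤r has ee [] b p = p
  sign-transfer (suc r) F v {K} {e} {e'} {suc n} (s≤s n≤r) has ee T bT p₀ with pick-max e T bT
  ... | (f , k) , T' , eqT , bf ∷ b , max =
    subst (λ z → 0ℤ ≤ᶻ v + z) (sym (eqT e')) (go (subst (λ z → 0ℤ ≤ᶻ v + z) (eqT e) p₀))
    where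
    C  = gap r F
    F' = bound r F
    C≤ : ∀ {c} → c ℕ.≤ suc C → 2 ℕ.+ c ℕ.≤ strength (suc r) F
    C≤ c≤ = ℕₚ.≤-trans (s≤s (s≤s c≤)) (ℕₚ.m≤m+n _ _)
    ee' : Similarᵉ (strength r F') e e'
    ee' = Similar-mono (ℕₚ.m≤n+m _ _) ee
    b' : Bounded F' T'
    b' = All.map (λ q → ℕₚ.≤-trans q (ℕₚ.m≤m+n F _)) b
    ahead : ∀ {l m} → e l ℕ.+ C ℕ.< e m → e' l ℕ.+ C ℕ.< e' m
    ahead {l} {m} q = subst (ℕ._≤ e' m) (ℕₚ.+-suc (e' l) C)
      (shift-≤ (suc C) l m (C≤ ℕₚ.≤-refl) ee (subst (ℕ._≤ e m) (sym (ℕₚ.+-suc (e l) C)) q))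
    assoc : ∀ a b c → a + (b + c) ≡ (a + c) + b
    assoc = solve-∀

    f-leads : ¬ f ≡ 0ℤ → All (λ s → e (proj₂ s) ℕ.+ C ℕ.< e k) T' →
      ∣ v ∣ ℕ.* D ^ C ℕ.≤ D ^ e k → ∣ v ∣ ℕ.* D ^ C ℕ.≤ D ^ e' k →
      0ℤ ≤ᶻ v + val e ((f , k) ∷ T') → 0ℤ ≤ᶻ v + val e' ((f , k) ∷ T')
    f-leads f≢0 far small small' p = subst (0ℤ ≤ᶻ_) (sym (assoc v (f * power D (e' k)) (val e' T')))
      (dominated⁻ (v + val e' T') (f * power D (e' k)) (leading v f k e' T' n≤r f≢0 b small' (All.map ahead far))
        (pos-coef f (e k) (e' k)
          (dominated⁺ (v + val e T') (f * power D (e k)) (leading v f k e T' n≤r f≢0 b small far)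
            (subst (0ℤ ≤ᶻ_) (assoc v (f * power D (e k)) (val e T')) p))))

    v-leads : ∀ l → e l ≡ log v → e' l ≡ log v → D ^ log v ℕ.≤ ∣ v ∣ → e k ℕ.+ C ℕ.< e l →
      0ℤ ≤ᶻ v + val e ((f , k) ∷ T') → 0ℤ ≤ᶻ v + val e' ((f , k) ∷ T')
    v-leads l eql eql' lo lt p = subst (0ℤ ≤ᶻ_) (ℤₚ.+-comm _ v)
      (dominated⁻ (val e' ((f , k) ∷ T')) v
        (trailing v (log v) e' ((f , k) ∷ T') (s≤s n≤r) (bf ∷ b) lo (All.map (λ q → subst (_ ℕ.≤_) eql' (ℕₚ.<⇒≤ (ahead q))) below))
        (dominated⁺ (val e ((f , k) ∷ T')) v
          (trailing v (log v) e ((f , k) ∷ T') (s≤s n≤r) (bf ∷ b) lo (All.map (λ q → subst (_ ℕ.≤_) eql (ℕₚ.<⇒≤ q)) below))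
          (subst (0ℤ ≤ᶻ_) (ℤₚ.+-comm v _) p)))
      where
      below : All (λ s → e (proj₂ s) ℕ.+ C ℕ.< e l) ((f , k) ∷ T')
      below = lt ∷ All.map (λ q → ℕₚ.≤-<-trans (ℕₚ.+-monoˡ-≤ C q) lt) max

    absorb : ∀ l → e l ≡ log v → e' l ≡ log v → e k ℕ.≤ e l ℕ.+ C → e l ℕ.≤ e k ℕ.+ C →
      0ℤ ≤ᶻ v + val e ((f , k) ∷ T') → 0ℤ ≤ᶻ v + val e' ((f , k) ∷ T')
    absorb l eql eql' hi lo p = subst (0ℤ ≤ᶻ_) (sym (trans (cong (λ z → v + (f * power D z + val e' T')) (sym same))
                                                          (sym (ℤₚ.+-assoc v (f * power D (e k)) _))))
      (subst (λ z → 0ℤ ≤ᶻ z + val e' T') veq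
        (sign-transfer r F' v⁺ n≤r (λ q → has (inj₂ (inj₂ (a , g , q)))) ee' T' b'
          (subst (λ z → 0ℤ ≤ᶻ z + val e T') (sym veq) (subst (0ℤ ≤ᶻ_) (sym (ℤₚ.+-assoc v (f * power D (e k)) _)) p))))
      where
      same : e k ≡ e' k
      same with ℕₚ.≤-total (e l) (e k)
      ... | inj₁ le = trans (sym (ℕₚ.m+[n∸m]≡n le)) (trans (cong (ℕ._+ (e k ℕ.∸ e l)) (trans eql (sym eql')))
              (sym (shift-≡ (e k ℕ.∸ e l) l k (C≤ (ℕₚ.m≤n⇒m≤1+n (ℕₚ.m≤n+o⇒m∸n≤o (e k) (e l) hi))) ee (sym (ℕₚ.m+[n∸m]≡n le)))))
      ... | inj₂ le = ℕₚ.+-cancelʳ-≡ (e l ℕ.∸ e k) (e k) (e' k) (trans (ℕₚ.m+[n∸m]≡n le) (trans (trans eql (sym eql'))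
              (shift-≡ (e l ℕ.∸ e k) k l (C≤ (ℕₚ.m≤n⇒m≤1+n (ℕₚ.m≤n+o⇒m∸n≤o (e l) (e k) lo))) ee (sym (ℕₚ.m+[n∸m]≡n le)))))
      g-val = (e k ℕ.+ C) ℕ.∸ log v
      g< : g-val ℕ.< suc (C ℕ.+ C)
      g< = s≤s (ℕₚ.m≤n+o⇒m∸n≤o (e k ℕ.+ C) (log v) (ℕₚ.≤-trans (ℕₚ.+-monoˡ-≤ C (subst (λ z → e k ℕ.≤ z ℕ.+ C) eql hi))
             (ℕₚ.≤-reflexive (ℕₚ.+-assoc (log v) C C))))
      g : Fin (suc (C ℕ.+ C))
      g = fromℕ< g<
      g-eq : (log v ℕ.+ toℕ g) ℕ.∸ C ≡ e k
      g-eq = trans (cong (λ z → (log v ℕ.+ z) ℕ.∸ C) (Finₚ.toℕ-fromℕ< g<))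
             (trans (cong (ℕ._∸ C) (ℕₚ.m+[n∸m]≡n (subst (ℕ._≤ e k ℕ.+ C) eql lo))) (ℕₚ.m+n∸n≡m (e k) C))
      bounds : ∀ f → ∣ f ∣ ℕ.≤ F → Σ (Fin (suc (F ℕ.+ F))) λ a → + toℕ a - + F ≡ f
      bounds (+ m) q = fromℕ< m< , trans (cong (λ z → + z - + F) (Finₚ.toℕ-fromℕ< m<))
                         (trans (cong (λ z → z - + F) (ℤₚ.pos-+ m F)) (lem (+ m) (+ F)))
        where
        m< : m ℕ.+ F ℕ.< suc (F ℕ.+ F)
        m< = s≤s (ℕₚ.+-monoˡ-≤ F q)
        lem : ∀ a b → (a + b) - b ≡ a
        lem = solve-∀
      bounds -[1+ m ] q = fromℕ< m< , trans (cong (λ z → + z - + F) (Finₚ.toℕ-fromℕ< m<))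
                         (trans (cong (λ z → + (F ℕ.∸ suc m) - + z) (sym (ℕₚ.m∸n+n≡m q)))
                         (trans (cong (λ z → + (F ℕ.∸ suc m) - z) (ℤₚ.pos-+ (F ℕ.∸ suc m) (suc m))) (lem (+ (F ℕ.∸ suc m)) (+ suc m))))
        where
        m< : F ℕ.∸ suc m ℕ.< suc (F ℕ.+ F)
        m< = s≤s (ℕₚ.≤-trans (ℕₚ.m∸n≤m F (suc m)) (ℕₚ.m≤m+n F F))
        lem : ∀ a b → a - (a + b) ≡ - b
        lem = solve-∀
      a = proj₁ (bounds f bf)
      v⁺ = v + (+ toℕ a - + F) * power D ((log v ℕ.+ toℕ g) ℕ.∸ C)
      veq : v⁺ ≡ v + f * power D (e k)
      veq = cong₂ (λ x y → v + x * power D y) (proj₂ (bounds f bf)) g-eq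

    smallness : ∀ l ε → ∣ v ∣ ℕ.< D ^ suc l → l ℕ.+ C ℕ.< ε → ∣ v ∣ ℕ.* D ^ C ℕ.≤ D ^ ε
    smallness l ε lt q = ℕₚ.≤-trans (ℕₚ.*-monoˡ-≤ (D ^ C) (ℕₚ.<⇒≤ lt))
      (ℕₚ.≤-trans (ℕₚ.≤-reflexive (sym (ℕₚ.^-distribˡ-+-* D (suc l) C))) (D^-mono q))

    go : 0ℤ ≤ᶻ v + val e ((f , k) ∷ T') → 0ℤ ≤ᶻ v + val e' ((f , k) ∷ T')
    go p with merge C f k (C≤ (ℕₚ.n≤1+n C)) ee bf T' b max
    ... | inj₂ (T″ , eq , eq' , b″) = subst (λ z → 0ℤ ≤ᶻ v + z) (sym eq')
            (sign-transfer r F' v n≤r (has ∘ inj₂ ∘ inj₁) ee' T″ b″ (subst (λ z → 0ℤ ≤ᶻ v + z) eq p))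
    ... | inj₁ far with f ℤ.≟ 0ℤ | log-spec v
    ...   | yes refl | _ = subst (λ z → 0ℤ ≤ᶻ v + z) (drop e')
            (sign-transfer r F' v n≤r (has ∘ inj₂ ∘ inj₁) ee' T' b' (subst (λ z → 0ℤ ≤ᶻ v + z) (sym (drop e)) p))
      where
      drop : ∀ e → val e T' ≡ 0ℤ * power D (e k) + val e T'
      drop e = sym (trans (cong (λ z → z + val e T') (ℤₚ.*-zeroˡ (power D (e k)))) (ℤₚ.+-identityˡ _))
    ...   | no f≢0 | inj₁ refl = f-leads f≢0 far z≤n z≤n p
    ...   | no f≢0 | inj₂ (lo , hi) with has (inj₁ tt)
    ...     | l , eql , eql' with e l ℕ.+ C ℕ.<? e k | e k ℕ.+ C ℕ.<? e l
    ...       | yes q | _ = f-leads f≢0 far (smallness (log v) (e k) hi (subst (λ z → z ℕ.+ C ℕ.< e k) eql q))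
                              (smallness (log v) (e' k) hi (subst (λ z → z ℕ.+ C ℕ.< e' k) eql' (ahead q))) p
    ...       | no _  | yes q = v-leads l eql eql' lo q p
    ...       | no ¬q | no ¬q' = absorb l eql eql' (ℕₚ.≮⇒≥ ¬q) (ℕₚ.≮⇒≥ ¬q') p

  -- Residues of powers of D

  period : ∀ m → Σ ℕ λ a → Σ ℕ λ π → a ℕ.+ suc π ℕ.≤ suc m × + suc m ∣ power D (a ℕ.+ suc π) - power D a
  -- D may share factors with the modulus, so its powers are only eventually periodic: a bounds the
  -- preperiod and `suc π` is a period.
  period m with Finₚ.pigeonhole (ℕₚ.n<1+n (suc m)) (λ i → fromℕ< (m%n<n (D ^ toℕ i) (suc m)))
  ... | i , j , i<j , eq = toℕ i , π , subst (ℕ._≤ suc m) (sym split) (ℕₚ.≤-pred (Finₚ.toℕ<n j)) ,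
        subst (λ z → + suc m ∣ power D z - power D (toℕ i)) (sym split)
          (divides (+ (D ^ toℕ j / suc m) - + (D ^ toℕ i / suc m)) (begin
            power D (toℕ j) - power D (toℕ i)   ≡⟨ cong₂ _-_ (expand (D ^ toℕ j)) (expand (D ^ toℕ i)) ⟩
            (+ (D ^ toℕ j % suc m) + + (D ^ toℕ j / suc m) * + suc m) - (+ (D ^ toℕ i % suc m) + + (D ^ toℕ i / suc m) * + suc m)
              ≡⟨ cong (λ z → (+ z + + (D ^ toℕ j / suc m) * + suc m) - (+ (D ^ toℕ i % suc m) + + (D ^ toℕ i / suc m) * + suc m)) (sym same) ⟩
            (+ (D ^ toℕ i % suc m) + + (D ^ toℕ j / suc m) * + suc m) - (+ (D ^ toℕ i % suc m) + + (D ^ toℕ i / suc m) * + suc m)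
              ≡⟨ lem (+ (D ^ toℕ i % suc m)) (+ (D ^ toℕ j / suc m)) (+ (D ^ toℕ i / suc m)) (+ suc m) ⟩
            (+ (D ^ toℕ j / suc m) - + (D ^ toℕ i / suc m)) * + suc m ∎))
    where
    open ≡-Reasoning
    π = toℕ j ℕ.∸ suc (toℕ i)
    split : toℕ i ℕ.+ suc π ≡ toℕ j
    split = trans (ℕₚ.+-suc (toℕ i) π) (ℕₚ.m+[n∸m]≡n i<j)
    same : D ^ toℕ i % suc m ≡ D ^ toℕ j % suc m
    same = trans (sym (Finₚ.toℕ-fromℕ< (m%n<n (D ^ toℕ i) (suc m)))) (trans (cong toℕ eq) (Finₚ.toℕ-fromℕ< (m%n<n (D ^ toℕ j) (suc m))))
    expand : ∀ n → + n ≡ + (n % suc m) + + (n / suc m) * + suc m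
    expand n = trans (cong +_ (m≡m%n+[m/n]*n n (suc m))) (trans (ℤₚ.pos-+ (n % suc m) _) (cong (λ z → + (n % suc m) + z) (ℤₚ.pos-* (n / suc m) (suc m))))
    lem : ∀ r a b m → (r + a * m) - (r + b * m) ≡ (a - b) * m
    lem = solve-∀

  periodic : ∀ m a π → + suc m ∣ power D (a ℕ.+ suc π) - power D a →
             ∀ q {b} → a ℕ.≤ b → + suc m ∣ power D (b ℕ.+ q ℕ.* suc π) - power D b
  periodic m a π per zero {b} a≤b = divides 0ℤ (ℤₚ.i≡j⇒i-j≡0 (cong (power D) (ℕₚ.+-identityʳ b)))
  periodic m a π per (suc q) {b} a≤b = subst (+ suc m ∣_) eq
    (∣m∣n⇒∣m+n (periodic m a π per q (ℕₚ.≤-trans a≤b (ℕₚ.m≤m+n b (suc π)))) (∣m⇒∣m*n (power D (b ℕ.∸ a)) per))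
    where
    b≡ : ∀ x → (a ℕ.+ x) ℕ.+ (b ℕ.∸ a) ≡ b ℕ.+ x
    b≡ x = trans (ℕₚ.+-assoc a x _) (trans (cong (a ℕ.+_) (ℕₚ.+-comm x _)) (trans (sym (ℕₚ.+-assoc a _ x)) (cong (ℕ._+ x) (ℕₚ.m+[n∸m]≡n a≤b))))
    lem : ∀ x y p a c → (x - y) + (p - a) * c ≡ x - y + (p * c - a * c)
    lem = solve-∀
    lem₂ : ∀ x y z → (x - y) + (y - z) ≡ x - z
    lem₂ = solve-∀
    eq : (power D (b ℕ.+ suc π ℕ.+ q ℕ.* suc π) - power D (b ℕ.+ suc π)) + (power D (a ℕ.+ suc π) - power D a) * power D (b ℕ.∸ a)
         ≡ power D (b ℕ.+ suc q ℕ.* suc π) - power D b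
    eq = trans (lem (power D (b ℕ.+ suc π ℕ.+ q ℕ.* suc π)) (power D (b ℕ.+ suc π)) (power D (a ℕ.+ suc π)) (power D a) (power D (b ℕ.∸ a)))
        (trans (cong₂ (λ x y → (power D (b ℕ.+ suc π ℕ.+ q ℕ.* suc π) - power D (b ℕ.+ suc π)) + (x - y))
                  (trans (sym (power-+ D (a ℕ.+ suc π) (b ℕ.∸ a))) (cong (power D) (b≡ (suc π))))
                  (trans (sym (power-+ D a (b ℕ.∸ a))) (cong (power D) (ℕₚ.m+[n∸m]≡n a≤b))))
        (trans (lem₂ (power D (b ℕ.+ suc π ℕ.+ q ℕ.* suc π)) (power D (b ℕ.+ suc π)) (power D b))
               (cong (λ z → power D z - power D b) (ℕₚ.+-assoc b (suc π) (q ℕ.* suc π)))))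

  constant : ∀ {σ} {K : Set} {e e' : K → ℕ} → Similarᵉ σ e e' → ∀ k → suc (e k) ℕ.≤ σ → e' k ≡ e k
  constant {e = e} {e'} ee k le = ℤₚ.+-injective (trans (sym (ℤₚ.+-identityʳ _))
    (trans (Similar-≡ ee (add {k = 0} (just k) nil) (copies (e k) nothing) le
             (trans (ℤₚ.+-identityʳ _) (sym (ones e)))) (ones e')))
    where
    ones : ∀ z → ⟦ copies (e k) nothing ⟧ (with-unit z) ≡ + e k
    ones z = trans (⟦⟧-copies (e k) nothing (with-unit z)) (ℤₚ.*-identityʳ _)

  -- An exponent below a is a small constant, which similarity fixes. From a on, the two exponents
  -- differ by a multiple of the period, because the period is itself at most s.
  power-residues : ∀ {s σ} {K : Set} {e e' : K → ℕ} → suc s ℕ.≤ σ → Similarᵉ σ e e' → ∀ m → suc m ℕ.≤ s → ∀ k →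
                + suc m ∣ power D (e' k) - power D (e k)
  power-residues {s} {σ} {e = e} {e'} s≤σ ee m m<s k with period m
  ... | a , π , aπ≤m , per with a ℕ.≤? e k | a ℕ.≤? e' k
  ...   | no ¬p | _     = divides 0ℤ (ℤₚ.i≡j⇒i-j≡0 (cong (power D) (constant ee k (small (ℕₚ.≰⇒> ¬p)))))
    where
    small : ∀ {x} → x ℕ.< a → suc x ℕ.≤ σ
    small lt = ℕₚ.≤-trans lt (ℕₚ.≤-trans (ℕₚ.m+n≤o⇒m≤o a aπ≤m) (ℕₚ.≤-trans m<s (ℕₚ.≤-trans (ℕₚ.n≤1+n s) s≤σ)))
  ...   | yes p | no ¬p = divides 0ℤ (ℤₚ.i≡j⇒i-j≡0 (cong (power D) (sym (constant (Similar-sym ee) k (small (ℕₚ.≰⇒> ¬p))))))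
    where
    small : ∀ {x} → x ℕ.< a → suc x ℕ.≤ σ
    small lt = ℕₚ.≤-trans lt (ℕₚ.≤-trans (ℕₚ.m+n≤o⇒m≤o a aπ≤m) (ℕₚ.≤-trans m<s (ℕₚ.≤-trans (ℕₚ.n≤1+n s) s≤σ)))
  ...   | yes p | yes p' with residues ee π (ℕₚ.≤-trans (ℕₚ.m+n≤o⇒n≤o a aπ≤m) (ℕₚ.≤-trans m<s (ℕₚ.≤-trans (ℕₚ.n≤1+n s) s≤σ))) (just k)
  ...     | divides q eq = oriented q eq
    where
    recover : ∀ x y → y ≡ x + (y - x)
    recover = solve-∀
    swap : ∀ x y → y - x ≡ - (x - y)
    swap = solve-∀
    steps : ∀ x y q → + y - + x ≡ + q * + suc π → y ≡ x ℕ.+ q ℕ.* suc π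
    steps x y q eq = ℤₚ.+-injective (trans (recover (+ x) (+ y)) (trans (cong (λ z → + x + z) (trans eq (sym (ℤₚ.pos-* q (suc π)))))
                           (sym (ℤₚ.pos-+ x (q ℕ.* suc π)))))
    oriented : ∀ q → + e' k - + e k ≡ q * + suc π → + suc m ∣ power D (e' k) - power D (e k)
    oriented (+ q) eq = subst (λ z → + suc m ∣ power D z - power D (e k)) (sym (steps (e k) (e' k) q eq)) (periodic m a π per q p)
    oriented -[1+ q ] eq = subst (+ suc m ∣_) (sym (swap (power D (e k)) (power D (e' k))))
      (∣m⇒∣-m (subst (λ z → + suc m ∣ power D z - power D (e' k))
        (sym (steps (e' k) (e k) (suc q) (trans (swap (+ e' k) (+ e k)) (trans (cong -_ eq) (ℤₚ.neg-distribˡ-* -[1+ q ] (+ suc π))))))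
        (periodic m a π per (suc q) p')))

  -- Thresholds defined from the parameters

  split : ∀ {k} {A K : Set} (w : Word (A ⊎ K) k) → Σ (Word A k) λ v → Σ ℕ λ n → Σ (Vec (ℤ × K) n) λ T →
          n ℕ.≤ k × Bounded 1 T × ∀ (α : A → ℤ) (e : K → ℕ) → ⟦ w ⟧ [ α , power D ∘ e ] ≡ ⟦ v ⟧ α + val e T
  split nil = nil , 0 , [] , z≤n , [] , λ _ _ → refl
  split (add (inj₁ i) w) with split w
  ... | v , n , T , n≤k , b , eq = add i v , n , T , ℕₚ.m≤n⇒m≤1+n n≤k , b , λ α e →
    trans (cong (λ z → α i + z) (eq α e)) (sym (ℤₚ.+-assoc (α i) (⟦ v ⟧ α) (val e T)))
  split (sub (inj₁ i) w) with split w
  ... | v , n , T , n≤k , b , eq = sub i v , n , T , ℕₚ.m≤n⇒m≤1+n n≤k , b , λ α e →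
    trans (cong (λ z → - α i + z) (eq α e)) (sym (ℤₚ.+-assoc (- α i) (⟦ v ⟧ α) (val e T)))
  split (add (inj₂ k) w) with split w
  ... | v , n , T , n≤k , b , eq = weaken (ℕₚ.n≤1+n _) v , suc n , (1ℤ , k) ∷ T , s≤s n≤k , s≤s z≤n ∷ b , λ α e →
    trans (cong (λ z → power D (e k) + z) (eq α e)) (trans (lem (power D (e k)) (⟦ v ⟧ α) (val e T))
      (cong (λ z → z + (1ℤ * power D (e k) + val e T)) (sym (⟦⟧-weaken (ℕₚ.n≤1+n _) v α))))
    where
    lem : ∀ x y z → x + (y + z) ≡ y + (1ℤ * x + z)
    lem = solve-∀
  split (sub (inj₂ k) w) with split w
  ... | v , n , T , n≤k , b , eq = weaken (ℕₚ.n≤1+n _) v , suc n , (- 1ℤ , k) ∷ T , s≤s n≤k , s≤s z≤n ∷ b , λ α e →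
    trans (cong (λ z → - power D (e k) + z) (eq α e)) (trans (lem (power D (e k)) (⟦ v ⟧ α) (val e T))
      (cong (λ z → z + (- 1ℤ * power D (e k) + val e T)) (sym (⟦⟧-weaken (ℕₚ.n≤1+n _) v α))))
    where
    lem : ∀ x y z → - x + (y + z) ≡ y + (- 1ℤ * x + z)
    lem = solve-∀

  -- A form of length s in parameters and powers is a word over the parameters plus at most s powers
  -- with coefficients 1 or -1, hence the 1 in `Path`. Only the word mentions parameters, so the
  -- thresholds are polynomially many.
  Threshold : ℕ → Set → Set
  Threshold s A = Word A s × Path s 1

  thresholds : ∀ s {A : Set} → (A → ℤ) → Threshold s A → ℕ
  thresholds s α (w , p) = threshold s 1 (⟦ w ⟧ α) p

  -- The start of the back-and-forth: `suc s` pays for residues of powers, `strength s 1` for signs.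
  Coupled-thresholds : ∀ s {A : Set} (α : A → ℤ) →
    Coupled D s (suc s ℕ.+ strength s 1) α α (thresholds s α) (thresholds s α)
  Coupled-thresholds s {A} α {J} η η' ee = similar (transfer-sign ee) (transfer-sign (Similar-sym ee)) λ where
      m m<s (inj₁ i) → divides 0ℤ (ℤₚ.i≡j⇒i-j≡0 {α i} refl)
      m m<s (inj₂ j) → power-residues (ℕₚ.m≤m+n (suc s) _) ee m m<s (inj₂ j)
    where
    x = thresholds s α
    transfer-sign : ∀ {η η' : J → ℕ} → Similarᵉ (suc s ℕ.+ strength s 1) [ x , η ] [ x , η' ] →
                    (w : Word (A ⊎ J) s) → 0ℤ ≤ᶻ ⟦ w ⟧ [ α , power D ∘ η ] → 0ℤ ≤ᶻ ⟦ w ⟧ [ α , power D ∘ η' ]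
    transfer-sign {η} {η'} ee w p with split (mapʷ (Sum.map id inj₂) w)
    ... | v , n , T , n≤s , b , eq = subst (0ℤ ≤ᶻ_) (sym (value η'))
          (sign-transfer s 1 (⟦ v ⟧ α) n≤s (λ q → inj₁ (v , q) , refl , refl)
            (Similar-mono (ℕₚ.m≤n+m _ (suc s)) ee) T b (subst (0ℤ ≤ᶻ_) (value η) p))
      where
      along : ∀ (η : J → ℕ) i → [ α , power D ∘ η ] i ≡ [ α , power D ∘ [ x , η ] ] (Sum.map id inj₂ i)
      along η (inj₁ i) = refl
      along η (inj₂ j) = refl
      value : ∀ η → ⟦ w ⟧ [ α , power D ∘ η ] ≡ ⟦ v ⟧ α + val [ x , η ] T
      value η = trans (⟦⟧-map _ w (along η)) (eq α [ x , η ])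

-- Counting codes

Embeds : Set → Set → Set
Embeds A B = Σ (A → B) λ f → ∀ {x y} → f x ≡ f y → x ≡ y

infixr 9 _⊚_
_⊚_ : ∀ {A B C} → Embeds B C → Embeds A B → Embeds A C
(g , gi) ⊚ (f , fi) = g ∘ f , fi ∘ gi

⊎-embeds : ∀ {A B C D} → Embeds A C → Embeds B D → Embeds (A ⊎ B) (C ⊎ D)
⊎-embeds {A} {B} (f , fi) (g , gi) = Sum.map f g , inj
  where
  inj : ∀ {x y : A ⊎ B} → Sum.map f g x ≡ Sum.map f g y → x ≡ y
  inj {inj₁ x} {inj₁ y} eq = cong inj₁ (fi (inj₁-injective eq))
  inj {inj₂ x} {inj₂ y} eq = cong inj₂ (gi (inj₂-injective eq))

×-embeds : ∀ {A B C D} → Embeds A C → Embeds B D → Embeds (A × B) (C × D)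
×-embeds (f , fi) (g , gi) = (λ (a , b) → f a , g b) , λ eq → cong₂ _,_ (fi (cong proj₁ eq)) (gi (cong proj₂ eq))

Fin-≤ : ∀ {m n} → m ℕ.≤ n → Embeds (Fin m) (Fin n)
Fin-≤ le = (λ i → inject≤ i le) , λ eq → Finₚ.inject≤-injective le le _ _ eq

Fin-⊎ : ∀ m n → Embeds (Fin m ⊎ Fin n) (Fin (m ℕ.+ n))
Fin-⊎ m n = join m n , λ eq → trans (sym (Finₚ.splitAt-join m n _)) (trans (cong (splitAt m) eq) (Finₚ.splitAt-join m n _))

Fin-× : ∀ m n → Embeds (Fin m × Fin n) (Fin (m ℕ.* n))
Fin-× m n = (λ (i , j) → combine i j) , λ {x} {y} eq →
  let (p , q) = Finₚ.combine-injective (proj₁ x) (proj₂ x) (proj₁ y) (proj₂ y) eq in cong₂ _,_ p q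

-- One constant is both shift and degree, so products and sums only require enlarging c.
Poly : (ℕ → Set) → Set
Poly A = Σ ℕ λ c → ∀ N → Embeds (A N) (Fin ((c ℕ.+ N) ^ c))

via : ∀ {A B : ℕ → Set} → (∀ N → Embeds (A N) (B N)) → Poly B → Poly A
via f (c , g) = c , λ N → g N ⊚ f N

^-mono : ∀ {a b m n} → a ℕ.≤ b → 1 ℕ.≤ b → m ℕ.≤ n → a ^ m ℕ.≤ b ^ n
^-mono {a} {b} {m} {n} a≤b 1≤b m≤n =
  ℕₚ.≤-trans (ℕₚ.^-monoˡ-≤ m a≤b) (ℕₚ.^-monoʳ-≤ b {{ℕ.>-nonZero 1≤b}} m≤n)

Poly-Fin : ∀ t → Poly (λ _ → Fin t)
Poly-Fin zero    = 0 , λ N → (λ ()) , λ { {()} }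
Poly-Fin (suc t) = suc t , λ N → Fin-≤ (ℕₚ.≤-trans (ℕₚ.≤-reflexive (sym (ℕₚ.*-identityʳ (suc t))))
  (^-mono {m = 1} {n = suc t} (ℕₚ.m≤m+n (suc t) N) (s≤s z≤n) (s≤s z≤n)))

Poly-id : Poly Fin
Poly-id = 1 , λ N → Fin-≤ (ℕₚ.≤-trans (ℕₚ.n≤1+n N) (ℕₚ.≤-reflexive (sym (ℕₚ.*-identityʳ (suc N)))))

Poly-⊤ : Poly (λ _ → ⊤)
Poly-⊤ = via (λ _ → (λ _ → zero) , λ _ → refl) (Poly-Fin 1)

Poly-⊥ : Poly (λ _ → ⊥)
Poly-⊥ = via (λ _ → (λ ()) , λ { {()} }) (Poly-Fin 0)

Poly-× : ∀ {A B} → Poly A → Poly B → Poly (λ N → A N × B N)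
Poly-× (c , f) (c' , g) = c ℕ.+ c' , λ N → Fin-≤ (le N) ⊚ Fin-× _ _ ⊚ ×-embeds (f N) (g N)
  where
  le : ∀ N → (c ℕ.+ N) ^ c ℕ.* (c' ℕ.+ N) ^ c' ℕ.≤ (c ℕ.+ c' ℕ.+ N) ^ (c ℕ.+ c')
  le N = ℕₚ.≤-trans (ℕₚ.*-mono-≤ (ℕₚ.^-monoˡ-≤ c (ℕₚ.+-monoˡ-≤ N (ℕₚ.m≤m+n c c')))
                                 (ℕₚ.^-monoˡ-≤ c' (ℕₚ.+-monoˡ-≤ N (ℕₚ.m≤n+m c' c))))
                    (ℕₚ.≤-reflexive (sym (ℕₚ.^-distribˡ-+-* (c ℕ.+ c' ℕ.+ N) c c')))

Poly-⊎ : ∀ {A B} → Poly A → Poly B → Poly (λ N → A N ⊎ B N)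
Poly-⊎ (c , f) (c' , g) = 2 ℕ.+ (c ℕ.+ c') , λ N → Fin-≤ (le N) ⊚ Fin-⊎ _ _ ⊚ ⊎-embeds (f N) (g N)
  where
  le : ∀ N → (c ℕ.+ N) ^ c ℕ.+ (c' ℕ.+ N) ^ c' ℕ.≤ (2 ℕ.+ (c ℕ.+ c') ℕ.+ N) ^ (2 ℕ.+ (c ℕ.+ c'))
  le N = begin
    (c ℕ.+ N) ^ c ℕ.+ (c' ℕ.+ N) ^ c'
      ≤⟨ ℕₚ.+-mono-≤ (^-mono (ℕₚ.+-monoˡ-≤ N (ℕₚ.≤-trans (ℕₚ.m≤m+n c c') (ℕₚ.m≤n+m _ 2))) (s≤s z≤n) (ℕₚ.m≤n⇒m≤1+n (ℕₚ.m≤m+n c c')))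
                      (^-mono (ℕₚ.+-monoˡ-≤ N (ℕₚ.≤-trans (ℕₚ.m≤n+m c' c) (ℕₚ.m≤n+m _ 2))) (s≤s z≤n) (ℕₚ.m≤n⇒m≤1+n (ℕₚ.m≤n+m c' c))) ⟩
    B ^ suc (c ℕ.+ c') ℕ.+ B ^ suc (c ℕ.+ c')
      ≡⟨ cong (B ^ suc (c ℕ.+ c') ℕ.+_) (sym (ℕₚ.+-identityʳ _)) ⟩
    2 ℕ.* B ^ suc (c ℕ.+ c')
      ≤⟨ ℕₚ.*-monoˡ-≤ (B ^ suc (c ℕ.+ c')) {2} {B} (s≤s (s≤s z≤n)) ⟩
    B ^ (2 ℕ.+ (c ℕ.+ c')) ∎
    where
    open ℕₚ.≤-Reasoning
    B = 2 ℕ.+ (c ℕ.+ c') ℕ.+ N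

Poly-Maybe : ∀ {A} → Poly A → Poly (Maybe ∘ A)
Poly-Maybe {A} p = via (λ N → maybe′ inj₂ (inj₁ tt) , inj N) (Poly-⊎ Poly-⊤ p)
  where
  inj : ∀ N {x y : Maybe (A N)} → maybe′ inj₂ (inj₁ tt) x ≡ maybe′ inj₂ (inj₁ tt) y → x ≡ y
  inj N {just x}  {just y}  eq = cong just (inj₂-injective eq)
  inj N {nothing} {nothing} eq = refl

Poly-Word : ∀ {A} k → Poly A → Poly (λ N → Word (A N) k)
Poly-Word zero p = via (λ N → (λ _ → tt) , λ { {nil} {nil} _ → refl }) Poly-⊤
Poly-Word {A} (suc k) p = via (λ N → f , inj N) (Poly-⊎ Poly-⊤ (Poly-⊎ AW AW))
  where
  AW = Poly-× p (Poly-Word k p)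
  f : ∀ {I} → Word I (suc k) → ⊤ ⊎ (I × Word I k ⊎ I × Word I k)
  f nil       = inj₁ tt
  f (add i w) = inj₂ (inj₁ (i , w))
  f (sub i w) = inj₂ (inj₂ (i , w))
  inj : ∀ N {x y : Word (A N) (suc k)} → f x ≡ f y → x ≡ y
  inj N {nil}     {nil}     eq   = refl
  inj N {add i w} {add j v} refl = refl
  inj N {sub i w} {sub j v} refl = refl

Poly-Code : ∀ {A} m s → Poly A → Poly (λ N → Code (A N) m s)
Poly-Code zero s p = via (λ N → (λ _ → tt) , λ { {done} {done} _ → refl }) Poly-⊤
Poly-Code {A} (suc m) s p = via (λ N → f , inj N)
    (Poly-× (Poly-Word (len s) (Poly-⊎ (Poly-Fin m) p)) (Poly-× (Poly-Fin s) (Poly-Code m (scale s) p)))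
  where
  f : ∀ {I} → Code I (suc m) s → Word (Fin m ⊎ I) (len s) × (Fin s × Code I m (scale s))
  f (more W h c) = W , h , c
  inj : ∀ N {x y : Code (A N) (suc m) s} → f x ≡ f y → x ≡ y
  inj N {more W h c} {more W' h' c'} refl = refl

Poly-Path : ∀ D 2≤D r F → Poly (λ _ → PowerSums.Path D 2≤D r F)
Poly-Path D 2≤D zero    F = Poly-⊥
Poly-Path D 2≤D (suc r) F = Poly-⊎ Poly-⊤ (Poly-⊎ P (Poly-× (Poly-Fin _) (Poly-× (Poly-Fin _) P)))
  where P = Poly-Path D 2≤D r _

-- With `i = 3 + c` and `N = 2 ^ (i + i)`, the left side is at most `2 ^ (suc (i + i) * c)`. Its
-- exponent is at most `2 ^ i * c`, which is below `2 ^ i * 2 ^ i = N`. The 3 ensures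
-- `suc (i + i) ≤ 2 ^ i`.
exponential-beats : ∀ c → Σ ℕ λ N → (c ℕ.+ N) ^ c ℕ.< 2 ^ N
exponential-beats c = 2 ^ (i ℕ.+ i) , ℕₚ.≤-<-trans
    (ℕₚ.≤-trans (ℕₚ.^-monoˡ-≤ c sum) (ℕₚ.≤-reflexive (ℕₚ.^-*-assoc 2 (suc (i ℕ.+ i)) c)))
    (ℕₚ.^-monoʳ-< 2 ℕₚ.≤-refl exponent)
  where
  i = 3 ℕ.+ c
  c<2^i : c ℕ.< 2 ^ i
  c<2^i = ℕₚ.≤-trans (s≤s (ℕₚ.m≤n+m c 3)) (n≤D^n ℕₚ.≤-refl i)
  double : ∀ t → suc ((3 ℕ.+ t) ℕ.+ (3 ℕ.+ t)) ℕ.≤ 2 ^ (3 ℕ.+ t)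
  double zero    = ℕₚ.n≤1+n 7
  double (suc t) = ℕₚ.≤-trans (ℕₚ.≤-reflexive (cong (2 ℕ.+_) (ℕₚ.+-suc (3 ℕ.+ t) (3 ℕ.+ t))))
    (ℕₚ.≤-trans (ℕₚ.≤-reflexive (ℕₚ.+-comm 2 (suc ((3 ℕ.+ t) ℕ.+ (3 ℕ.+ t)))))
    (ℕₚ.≤-trans (ℕₚ.+-mono-≤ (double t) (ℕₚ.≤-trans (s≤s (s≤s z≤n)) (double t)))
                (ℕₚ.≤-reflexive (cong (2 ^ (3 ℕ.+ t) ℕ.+_) (sym (ℕₚ.+-identityʳ _))))))
  sum : c ℕ.+ 2 ^ (i ℕ.+ i) ℕ.≤ 2 ^ suc (i ℕ.+ i)
  sum = ℕₚ.≤-trans (ℕₚ.+-monoˡ-≤ (2 ^ (i ℕ.+ i)) (ℕₚ.≤-trans (ℕₚ.<⇒≤ c<2^i) (ℕₚ.^-monoʳ-≤ 2 (ℕₚ.m≤m+n i i))))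
                   (ℕₚ.≤-reflexive (cong (2 ^ (i ℕ.+ i) ℕ.+_) (sym (ℕₚ.+-identityʳ _))))
  exponent : suc (i ℕ.+ i) ℕ.* c ℕ.< 2 ^ (i ℕ.+ i)
  exponent = ℕₚ.≤-<-trans (ℕₚ.*-monoˡ-≤ c (double c)) (subst (2 ^ i ℕ.* c ℕ.<_) (sym (ℕₚ.^-distribˡ-+-* 2 i i))
    (ℕₚ.*-monoʳ-< (2 ^ i) {{ℕ.>-nonZero (ℕₚ.≤-trans (s≤s z≤n) c<2^i)}} c<2^i))

-- Shattering against the number of codes

¬¬-Fin : ∀ {n} {P : Fin n → Set} → (∀ i → ¬ ¬ P i) → ¬ ¬ (∀ i → P i)
¬¬-Fin {zero}  h none = none λ ()
¬¬-Fin {suc n} h none = h zero λ p → ¬¬-Fin (h ∘ suc) λ ps → none λ { zero → p ; (suc i) → ps i }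

subset : ∀ {N} → Fin (2 ^ N) → Fin N → Bool
subset J i with finToFun J i
... | zero  = false
... | suc _ = true

funToFin-cong : ∀ {m n} {f g : Fin m → Fin n} → (∀ i → f i ≡ g i) → funToFin f ≡ funToFin g
funToFin-cong {zero}  eq = refl
funToFin-cong {suc m} eq = cong₂ combine (eq zero) (funToFin-cong (eq ∘ suc))

subset-injective : ∀ {N} (J J' : Fin (2 ^ N)) → (∀ i → T (subset J i) → T (subset J' i)) →
                   (∀ i → T (subset J' i) → T (subset J i)) → J ≡ J'
subset-injective {N} J J' to from = trans (sym (Finₚ.funToFin-finToFin {N} J))
  (trans (funToFin-cong pointwise) (Finₚ.funToFin-finToFin {N} J'))
  where
  pointwise : ∀ i → finToFun {2} {N} J i ≡ finToFun J' i
  pointwise i with finToFun {2} {N} J i | finToFun {2} {N} J' i | to i | from i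
  ... | zero     | zero     | _ | _ = refl
  ... | zero     | suc zero | _ | f = ⊥-elim (f tt)
  ... | suc zero | zero     | t | _ = ⊥-elim (t tt)
  ... | suc zero | suc zero | _ | _ = refl

module NIP {d D : ℕ} (base : Base d D) (k m : ℕ) (φ : Formula (k ℕ.+ m)) where
  open Invariance base
  open PowerSums D (2≤base base)

  -- Chosen backwards from φ: s to evaluate it, S to have s left after the m entries of b, σ for the
  -- coupling over thresholds of level S, τ for the exponents at that σ.
  s S σ τ L : ℕ
  s = 2 ℕ.+ scaleᶠ φ
  S = scale^ m s
  σ = suc S ℕ.+ strength S 1
  τ = 2 ℕ.+ (σ ℕ.+ strengthᶠ φ σ)
  L = letters m s

  Param : ℕ → Set
  Param N = Fin N × Fin k

  Codes : ℕ → Set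
  Codes N = Code (Param N ⊎ Fin L) m s × Code (Maybe (Threshold S (Param N))) L τ

  Poly-Codes : Poly Codes
  Poly-Codes = Poly-× (Poly-Code m s (Poly-⊎ param (Poly-Fin L)))
                      (Poly-Code L τ (Poly-Maybe (Poly-× (Poly-Word S param) (Poly-Path D (2≤base base) S 1))))
    where param = Poly-× Poly-id (Poly-Fin k)

  module _ {N : ℕ} (a : Fin N → Vector ℤ k) where
    α : Param N → ℤ
    α (i , j) = a i j

    x : Threshold S (Param N) → ℕ
    x = thresholds S α

    Decodes : Codes N → Vector ℕ L → Vector ℤ m → Set
    Decodes (zc , xc) ε b = Solves xc (with-unit x) (+_ ∘ ε) × Solves zc [ α , power D ∘ ε ] b

    Decodes-unique : ∀ c {ε ε' b b'} → Decodes c ε b → Decodes c ε' b' → ∀ j → b j ≡ b' j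
    Decodes-unique (zc , xc) {ε} {ε'} (xd , zd) (xd' , zd') = Solves-unique zc same zd zd'
      where
      same : ∀ i → [ α , power D ∘ ε ] i ≡ [ α , power D ∘ ε' ] i
      same (inj₁ i) = refl
      same (inj₂ j) = cong (power D) (ℤₚ.+-injective (Solves-unique xc (λ _ → refl) xd xd' j))

    -- Vectors are functions, and equal codes give tuples that agree only pointwise; hence the
    -- quantification over u.
    Traces : (Fin N → Bool) → Vector ℤ m → Set
    Traces J b = ∀ i u → (∀ j → u j ≡ (a i ++ b) j) → (Sat d u φ → T (J i)) × (T (J i) → Sat d u φ)

    -- `Coupled-step` from α and its thresholds to themselves. A single coupling covers all
    -- parameters, and restricting it along `place i` gives the invariance of φ on row i, so one b'
    -- serves all rows.
    representative : ∀ J b → (∀ i → (Sat d (a i ++ b) φ → T (J i)) × (T (J i) → Sat d (a i ++ b) φ)) →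
      ¬ ¬ Σ (Codes N) λ c → Σ (Vector ℕ L) λ ε → Σ (Vector ℤ m) λ b' → Decodes c ε b' × Traces J b'
    representative J b tr none =
      Coupled-step {m = m} {s} {σ} {τ} {u = α} {α} {x} {x} (2≤base base) (s≤s (s≤s z≤n)) (s≤s (s≤s z≤n))
        (ℕₚ.≤-trans (ℕₚ.m≤m+n σ _) (ℕₚ.m≤n+m _ 2)) (Similar-refl _) (Coupled-thresholds S α) b
        λ (b' , ε , ε' , zc , xc , xd , zd , ee , r) → none ((zc , xc) , ε' , b' , (xd , zd) , λ i u eq →
          let r' = Coupled-pull (place i) (placed b i) (λ j → trans (eq j) (placed b' i j)) r
              r″ = Coupled-pull (place i) (λ j → trans (eq j) (placed b' i j)) (placed b i) (Coupled-sym r)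
          in (λ p → proj₁ (tr i) (invariant φ zle ele (Similar-sym ee) r″ p)) ,
             (λ p → invariant φ zle ele ee r' (proj₂ (tr i) p)))
      where
      zle : scaleᶠ φ ℕ.≤ s
      zle = ℕₚ.m≤n+m _ 2
      ele : strengthᶠ φ σ ℕ.≤ τ
      ele = ℕₚ.≤-trans (ℕₚ.m≤n+m _ σ) (ℕₚ.m≤n+m _ 2)
      place : Fin N → Fin (k ℕ.+ m) → Fin m ⊎ Param N
      place i j = [ (λ j → inj₂ (i , j)) , inj₁ ] (splitAt k j)
      placed : ∀ b i j → (a i ++ b) j ≡ [ b , α ] (place i j)
      placed b i j with splitAt k j
      ... | inj₁ _ = refl
      ... | inj₂ _ = refl

  collide : ∀ {N n} (a : Fin N → Vector ℤ k) → Embeds (Codes N) (Fin n) → n ℕ.< 2 ^ N →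
    ¬ (∀ J → Σ (Codes N) λ c → Σ (Vector ℕ L) λ ε → Σ (Vector ℤ m) λ b → Decodes a c ε b × Traces a (subset J) b)
  collide {N} a (index , index-injective) lt w with Finₚ.pigeonhole lt (index ∘ proj₁ ∘ w)
  ... | J , J' , J<J' , eq = Finₚ.<⇒≢ J<J' (subset-injective J J' (smaller J J' (index-injective eq))
                                                                   (smaller J' J (sym (index-injective eq))))
    where
    smaller : ∀ J J' → proj₁ (w J) ≡ proj₁ (w J') → ∀ i → T (subset J i) → T (subset J' i)
    smaller J J' eq i p with w J | w J'
    smaller J J' refl i p | c , ε , b , d , tr | .c , ε' , b' , d' , tr' =
      proj₁ (tr' i (a i ++ b) (same (splitAt k))) (proj₂ (tr i (a i ++ b) (λ _ → refl)) p)
      where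
      same : ∀ (split : Fin (k ℕ.+ m) → Fin k ⊎ Fin m) j → [ a i , b ] (split j) ≡ [ a i , b' ] (split j)
      same split j with split j
      ... | inj₁ _ = refl
      ... | inj₂ l = Decodes-unique a c {ε} {ε'} d d' l

  bounded : Poly Codes → NIPFormula d k m φ
  bounded (c , embed) shatters with exponential-beats c
  ... | N , lt with shatters N
  -- Representatives exist only under double negation, but the subsets are finitely many, so they
  -- can all be chosen inside a single one.
  ...   | a , traced = ¬¬-Fin (λ J none → traced (subset J) λ (b , tr) → representative a (subset J) b tr none)
                              (collide a (embed N) lt)

nip : ∀ {d D} → Base d D → NIPTheory d
nip base k m φ = NIP.bounded base k m φ (NIP.Poly-Codes base k m φ)

theorem6p9 : (d : ℕ) → 1 ≤ d → NIPTheory d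
theorem6p9 (suc zero)    _ = nip two
theorem6p9 (suc (suc d)) _ = nip (itself (s≤s (s≤s z≤n)))
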